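{- Let $r\in\mathbb{N}_0$ be fixed, and let $E_{n;r}$ and $V_{n;r}$ denote the expectation and variance of the number of $r$-branches of a binary tree chosen uniformly at random among all binary trees with $n$ inner nodes. Then, as $n\to\infty$, \[ E_{n;r}=\frac{n}{4^r}+\frac16\Big(1+\frac{5}{4^r}\Big)+\frac{1}{20n}\Big(4^r-\frac{1}{4^r}\Big)+\frac{1}{12n^2}\Big(\frac{5\cdot16^r}{21}-\frac{7\cdot4^r}{10}+\frac{97}{210\cdot4^r}\Big)+O(n^{ -3}), \] \[ V_{n;r}=\frac{4^r-1}{3\cdot16^r}\,n-\frac{2\cdot16^r-25\cdot4^r+23}{90\cdot16^r}-\frac{13\cdot64^r-14\cdot16^r+7\cdot4^r-6}{420\cdot16^r\,n}+O(n^{ -2}). \]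
   Context: A binary tree is either a leaf $\square$ or an inner node with an ordered pair of subtrees (left, right) which are binary trees; its size is its number of inner nodes. The register function is defined by $\mathrm{Reg}(\square)=0$, and for a tree with subtrees $t_1,t_2$: $\mathrm{Reg}(t)=\max\{\mathrm{Reg}(t_1),\mathrm{Reg}(t_2)\}$ if these differ, and $\mathrm{Reg}(t_1)+1$ otherwise. Label every node (inner node or leaf) of a tree $t$ by the register function of the subtree rooted at it. An $r$-branch of $t$ is a maximal chain of nodes labeled $r$, i.e. a connected component (with respect to the parent–child edges) of the set of nodes labeled $r$; such a component is always a path going downward from a node. The nodes of $t$ are partitioned into $r$-branches, $r\ge0$. -}

module Defs where

open import Data.Empty using (⊥; ⊥-elim)
open import Data.Fin.Base using (Fin)
import Data.Fin.Properties as Fin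
import Data.Integer.Base as ℤ
import Data.Integer.Literals as ℤ
open import Data.List.Base using (List; []; _∷_; length; map; foldr; concatMap; cartesianProductWith; upTo)
open import Data.List.Membership.Propositional using (_∈_; find; lose)
open import Data.List.Membership.Propositional.Properties using (∈-concatMap⁺; ∈-concatMap⁻; ∈-cartesianProductWith⁺; ∈-cartesianProductWith⁻; ∈-upTo⁺; ∈-upTo⁻)
import Data.List.Relation.Unary.All as All
import Data.List.Relation.Unary.All.Properties as All
open import Data.List.Relation.Unary.AllPairs using ([]; _∷_)
import Data.List.Relation.Unary.AllPairs as AllPairs
import Data.List.Relation.Unary.AllPairs.Properties as AllPairs
open import Data.List.Relation.Unary.Any using (here; there)
open import Data.List.Relation.Unary.Unique.Propositional using (Unique)
import Data.List.Relation.Unary.Unique.Propositional.Properties as Unique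
open import Data.Nat.Base as ℕ using (ℕ; zero; suc; s≤s; s≤s⁻¹; NonZero)
import Data.Nat.Literals as ℕ
import Data.Nat.Properties as ℕ
open import Data.Product.Base using (∃; _×_; _,_; proj₁; proj₂)
open import Data.Rational.Base as ℚ using (ℚ; 0ℚ)
import Data.Rational.Literals as ℚ
open import Data.Sum.Base using (_⊎_; inj₁; inj₂)
open import Data.Sum.Function.Propositional using (_⊎-↔_)
open import Data.Tree.Binary using (Tree; leaf; node; #nodes)
open import Data.Unit.Base using (⊤; tt)
open import Function.Base using (_∘_; _on_)
open import Function.Bundles using (Inverse; _↔_; _⇔_; mk⇔)
open import Level using (0ℓ)
open import Relation.Binary.Bundles using (Setoid)
open import Relation.Binary.Construct.Closure.Equivalence using (EqClosure; setoid; gmap; symmetric)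
open import Relation.Binary.Construct.Closure.ReflexiveTransitive using (ε; _◅_)
open import Relation.Binary.Construct.Closure.Symmetric using (fwd; bwd)
open import Relation.Binary.Core using (Rel)
open import Relation.Binary.PropositionalEquality using (_≡_; _≢_; refl; sym; trans; cong; subst)
open import Relation.Nullary using (Dec; yes; no)

BinaryTree : Set
BinaryTree = Tree ⊤ ⊤

combine : ℕ → ℕ → ℕ
combine a b with a ℕ.≟ b
... | yes _ = suc a
... | no  _ = a ℕ.⊔ b

Reg : BinaryTree → ℕ
Reg (leaf _)       = 0
Reg (node t₁ _ t₂) = combine (Reg t₁) (Reg t₂)

-- All nodes of a tree, leaves included.
data Node : BinaryTree → Set where
  root  : ∀ {t} → Node t
  left  : ∀ {t₁ t₂ x} → Node t₁ → Node (node t₁ x t₂)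
  right : ∀ {t₁ t₂ x} → Node t₂ → Node (node t₁ x t₂)

subtree : ∀ {t} → Node t → BinaryTree
subtree {t} root  = t
subtree (left v)  = subtree v
subtree (right v) = subtree v

label : ∀ {t} → Node t → ℕ
label v = Reg (subtree v)

data ParentOf : ∀ {t} → Rel (Node t) 0ℓ where
  root-left  : ∀ {t₁ t₂ x} → ParentOf {node t₁ x t₂} root (left root)
  root-right : ∀ {t₁ t₂ x} → ParentOf {node t₁ x t₂} root (right root)
  in-left    : ∀ {t₁ t₂ x v w} → ParentOf {t₁} v w → ParentOf {node t₁ x t₂} (left v) (left w)
  in-right   : ∀ {t₁ t₂ x v w} → ParentOf {t₂} v w → ParentOf {node t₁ x t₂} (right v) (right w)

Labelled : ℕ → BinaryTree → Set
Labelled r t = ∃ λ (v : Node t) → label v ≡ r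

Edge : ∀ r t → Rel (Labelled r t) 0ℓ
Edge r t = ParentOf on proj₁

-- The r-branches of t are the elements of this quotient: nodes labelled r,
-- two of them being identified when joined by a path of nodes labelled r.
Branch : ℕ → BinaryTree → Setoid 0ℓ 0ℓ
Branch r t = setoid (Edge r t)

private

  combine-irr : ∀ {a b} → combine a b ≡ a → b ≢ a
  combine-irr {a} {b} eq refl with a ℕ.≟ b
  ... | yes _   = ℕ.1+n≢n eq
  ... | no  a≢a = a≢a refl

  combine-irr′ : ∀ {a b} → combine a b ≡ b → a ≢ b
  combine-irr′ {a} {b} eq refl = combine-irr {a} {a} eq refl

  record Classes (r : ℕ) (t : BinaryTree) (I : Set) : Set where
    field
      to      : Labelled r t → I
      from    : I → Labelled r t
      to-edge : ∀ {v w} → Edge r t v w → to v ≡ to w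
      to-from : ∀ i → to (from i) ≡ i
      from-to : ∀ v → EqClosure (Edge r t) (from (to v)) v

  module _ {r t I} (C : Classes r t I) where
    open Classes C

    to-path : ∀ {v w} → EqClosure (Edge r t) v w → to v ≡ to w
    to-path ε            = refl
    to-path (fwd e ◅ es) = trans (to-edge e) (to-path es)
    to-path (bwd e ◅ es) = trans (sym (to-edge e)) (to-path es)

    relabel : ∀ {v} (p q : label v ≡ r) → to (v , p) ≡ to (v , q)
    relabel {v} p q = cong (λ p → to (v , p)) (ℕ.≡-irrelevant p q)

    reindex : ∀ {J : Set} → J ↔ I → Classes r t J
    reindex J↔I = record
      { to      = J.from ∘ to
      ; from    = from ∘ J.to
      ; to-edge = cong J.from ∘ to-edge
      ; to-from = λ j → trans (cong J.from (to-from (J.to j))) (J.strictlyInverseʳ j)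
      ; from-to = λ v → subst (λ i → EqClosure (Edge r t) (from i) v) (sym (J.strictlyInverseˡ (to v))) (from-to v)
      }
      where module J = Inverse J↔I

  inverse : ∀ {r t k} → Classes r t (Fin k) → Inverse (Branch r t) (Fin.≡-setoid k)
  inverse {r} {t} {k} C = record
    { to        = to
    ; from      = from
    ; to-cong   = to-path C
    ; from-cong = λ { refl → ε }
    ; inverse   = (λ {i} v≈ → trans (to-path C v≈) (to-from i)) , (λ { {v} refl → from-to v })
    }
    where open Classes C

  leaf-zero : Classes 0 (leaf tt) ⊤
  leaf-zero = record
    { to      = λ _ → tt
    ; from    = λ _ → root , refl
    ; to-edge = λ _ → refl
    ; to-from = λ _ → refl
    ; from-to = λ { (root , refl) → ε }
    }

  leaf-pos : ∀ {r} → 0 ≢ r → Classes r (leaf tt) ⊥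
  leaf-pos 0≢r = record
    { to      = λ { (root , p) → 0≢r p }
    ; from    = λ ()
    ; to-edge = λ { {root , p} → ⊥-elim (0≢r p) }
    ; to-from = λ ()
    ; from-to = λ { (root , p) → ⊥-elim (0≢r p) }
    }

  module _ {r t₁ t₂} {I J : Set} (C₁ : Classes r t₁ I) (C₂ : Classes r t₂ J) where
    private
      module C₁ = Classes C₁
      module C₂ = Classes C₂
      t = node t₁ tt t₂

      inˡ : Labelled r t₁ → Labelled r t
      inˡ (v , p) = left v , p

      inʳ : Labelled r t₂ → Labelled r t
      inʳ (v , p) = right v , p

      pathˡ : ∀ {v w} → EqClosure (Edge r t₁) v w → EqClosure (Edge r t) (inˡ v) (inˡ w)
      pathˡ = gmap inˡ in-left

      pathʳ : ∀ {v w} → EqClosure (Edge r t₂) v w → EqClosure (Edge r t) (inʳ v) (inʳ w)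
      pathʳ = gmap inʳ in-right

      fromᵇ : I ⊎ J → Labelled r t
      fromᵇ (inj₁ i) = inˡ (C₁.from i)
      fromᵇ (inj₂ j) = inʳ (C₂.from j)

    -- The class of the root, when it has label r, is given by c.
    module Old (c : Reg t ≡ r → I ⊎ J)
               (c-left  : ∀ p (q : Reg t₁ ≡ r) → c p ≡ inj₁ (C₁.to (root , q)))
               (c-right : ∀ p (q : Reg t₂ ≡ r) → c p ≡ inj₂ (C₂.to (root , q)))
               (c-path  : ∀ p → EqClosure (Edge r t) (fromᵇ (c p)) (root , p)) where

      toᵒ : Labelled r t → I ⊎ J
      toᵒ (root    , p) = c p
      toᵒ (left v  , p) = inj₁ (C₁.to (v , p))
      toᵒ (right v , p) = inj₂ (C₂.to (v , p))

      to-edgeᵒ : ∀ {v w} → Edge r t v w → toᵒ v ≡ toᵒ w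
      to-edgeᵒ {_ , p} {_ , q} root-left    = c-left p q
      to-edgeᵒ {_ , p} {_ , q} root-right   = c-right p q
      to-edgeᵒ {_ , p} {_ , q} (in-left e)  = cong inj₁ (C₁.to-edge e)
      to-edgeᵒ {_ , p} {_ , q} (in-right e) = cong inj₂ (C₂.to-edge e)

      to-fromᵒ : ∀ i → toᵒ (fromᵇ i) ≡ i
      to-fromᵒ (inj₁ i) = cong inj₁ (C₁.to-from i)
      to-fromᵒ (inj₂ j) = cong inj₂ (C₂.to-from j)

      from-toᵒ : ∀ v → EqClosure (Edge r t) (fromᵇ (toᵒ v)) v
      from-toᵒ (root    , p) = c-path p
      from-toᵒ (left v  , p) = pathˡ (C₁.from-to (v , p))
      from-toᵒ (right v , p) = pathʳ (C₂.from-to (v , p))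

      old : Classes r t (I ⊎ J)
      old = record { to = toᵒ ; from = fromᵇ ; to-edge = to-edgeᵒ ; to-from = to-fromᵒ ; from-to = from-toᵒ }

    no-root : Reg t ≢ r → Classes r t (I ⊎ J)
    no-root ≢r = Old.old (⊥-elim ∘ ≢r) (⊥-elim ∘ ≢r) (⊥-elim ∘ ≢r) (⊥-elim ∘ ≢r)

    join-left : Reg t ≡ r → Reg t₁ ≡ r → Classes r t (I ⊎ J)
    join-left p q = Old.old
      (λ _ → inj₁ (C₁.to (root , q)))
      (λ _ q′ → cong inj₁ (relabel C₁ q q′))
      (λ _ q′ → ⊥-elim (combine-irr {Reg t₁} (trans p (sym q)) (trans q′ (sym q))))
      (λ _ → symmetric _ (fwd root-left ◅ symmetric _ (pathˡ (C₁.from-to (root , q)))))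

    join-right : Reg t ≡ r → Reg t₂ ≡ r → Classes r t (I ⊎ J)
    join-right p q = Old.old
      (λ _ → inj₂ (C₂.to (root , q)))
      (λ _ q′ → ⊥-elim (combine-irr′ {Reg t₁} (trans p (sym q)) (trans q′ (sym q))))
      (λ _ q′ → cong inj₂ (relabel C₂ q q′))
      (λ _ → symmetric _ (fwd root-right ◅ symmetric _ (pathʳ (C₂.from-to (root , q)))))

    module New (p₀ : Reg t ≡ r) (≢₁ : Reg t₁ ≢ r) (≢₂ : Reg t₂ ≢ r) where

      toⁿ : Labelled r t → ⊤ ⊎ (I ⊎ J)
      toⁿ (root    , _) = inj₁ tt
      toⁿ (left v  , p) = inj₂ (inj₁ (C₁.to (v , p)))
      toⁿ (right v , p) = inj₂ (inj₂ (C₂.to (v , p)))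

      fromⁿ : ⊤ ⊎ (I ⊎ J) → Labelled r t
      fromⁿ (inj₁ _) = root , p₀
      fromⁿ (inj₂ i) = fromᵇ i

      to-edgeⁿ : ∀ {v w} → Edge r t v w → toⁿ v ≡ toⁿ w
      to-edgeⁿ {_ , p} {_ , q} root-left    = ⊥-elim (≢₁ q)
      to-edgeⁿ {_ , p} {_ , q} root-right   = ⊥-elim (≢₂ q)
      to-edgeⁿ {_ , p} {_ , q} (in-left e)  = cong (inj₂ ∘ inj₁) (C₁.to-edge e)
      to-edgeⁿ {_ , p} {_ , q} (in-right e) = cong (inj₂ ∘ inj₂) (C₂.to-edge e)

      to-fromⁿ : ∀ i → toⁿ (fromⁿ i) ≡ i
      to-fromⁿ (inj₁ _)        = refl
      to-fromⁿ (inj₂ (inj₁ i)) = cong (inj₂ ∘ inj₁) (C₁.to-from i)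
      to-fromⁿ (inj₂ (inj₂ j)) = cong (inj₂ ∘ inj₂) (C₂.to-from j)

      from-toⁿ : ∀ v → EqClosure (Edge r t) (fromⁿ (toⁿ v)) v
      from-toⁿ (root    , p) = subst (λ q → EqClosure (Edge r t) (root , p₀) (root , q)) (ℕ.≡-irrelevant p₀ p) ε
      from-toⁿ (left v  , p) = pathˡ (C₁.from-to (v , p))
      from-toⁿ (right v , p) = pathʳ (C₂.from-to (v , p))

      new : Classes r t (⊤ ⊎ (I ⊎ J))
      new = record { to = toⁿ ; from = fromⁿ ; to-edge = to-edgeⁿ ; to-from = to-fromⁿ ; from-to = from-toⁿ }

-- 1 when a node labelled a whose children are labelled b and c starts a new r-branch.
starts : ∀ {r a b c : ℕ} → Dec (a ≡ r) → Dec (b ≡ r) → Dec (c ≡ r) → ℕ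
starts (yes _) (no _) (no _) = 1
starts _       _      _      = 0

branchCount : ℕ → BinaryTree → ℕ
branchCount r (leaf _) with 0 ℕ.≟ r
... | yes _ = 1
... | no  _ = 0
branchCount r t@(node t₁ _ t₂) =
  starts (Reg t ℕ.≟ r) (Reg t₁ ℕ.≟ r) (Reg t₂ ℕ.≟ r) ℕ.+ (branchCount r t₁ ℕ.+ branchCount r t₂)

private

  classes : ∀ r t → Classes r t (Fin (branchCount r t))
  classes r (leaf _) with 0 ℕ.≟ r
  ... | yes refl = reindex leaf-zero Fin.1↔⊤
  ... | no  0≢r  = reindex (leaf-pos 0≢r) Fin.0↔⊥
  classes r t@(node t₁ _ t₂) with Reg t ℕ.≟ r | Reg t₁ ℕ.≟ r | Reg t₂ ℕ.≟ r
  ... | yes p | yes q  | _      = reindex (join-left  (classes r t₁) (classes r t₂) p q) Fin.+↔⊎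
  ... | yes p | no _   | yes q  = reindex (join-right (classes r t₁) (classes r t₂) p q) Fin.+↔⊎
  ... | yes p | no ≢₁  | no ≢₂  = reindex (reindex (New.new (classes r t₁) (classes r t₂) p ≢₁ ≢₂) (Fin.1↔⊤ ⊎-↔ Fin.+↔⊎)) Fin.+↔⊎
  ... | no ≢r | _      | _      = reindex (no-root (classes r t₁) (classes r t₂) ≢r) Fin.+↔⊎

-- t has k r-branches: the quotient Branch r t is in bijection with Fin k.
branches : ∀ r t → ∃ λ k → Inverse (Branch r t) (Fin.≡-setoid k)
branches r t = branchCount r t , inverse (classes r t)

#branches : ℕ → BinaryTree → ℕ
#branches r t = proj₁ (branches r t)

node′ : BinaryTree → BinaryTree → BinaryTree
node′ t₁ t₂ = node t₁ tt t₂

enumerate : (fuel n : ℕ) → List BinaryTree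
enumerate _        zero    = leaf tt ∷ []
enumerate zero     (suc n) = []
enumerate (suc f)  (suc n) =
  concatMap (λ i → cartesianProductWith node′ (enumerate f i) (enumerate f (n ℕ.∸ i))) (upTo (suc n))

sound : ∀ f n {t} → t ∈ enumerate f n → #nodes t ≡ n
sound _       zero    (here refl) = refl
sound (suc f) (suc n) t∈
  with i , i∈ , t∈ᵢ ← find (∈-concatMap⁻ _ {upTo (suc n)} t∈)
  with t₁ , t₂ , t₁∈ , t₂∈ , refl ← ∈-cartesianProductWith⁻ node′ (enumerate f i) (enumerate f (n ℕ.∸ i)) t∈ᵢ
  rewrite sound f i t₁∈ | sound f (n ℕ.∸ i) t₂∈
  = trans (ℕ.+-suc i _) (cong suc (ℕ.m+[n∸m]≡n (s≤s⁻¹ (∈-upTo⁻ i∈))))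

complete : ∀ f t → #nodes t ℕ.≤ f → t ∈ enumerate f (#nodes t)
complete f (leaf tt) _ = here refl
complete f (node t₁ tt t₂) ≤f rewrite ℕ.+-suc (#nodes t₁) (#nodes t₂) with suc f ← f =
  ∈-concatMap⁺ _ (lose (∈-upTo⁺ (s≤s (ℕ.m≤m+n (#nodes t₁) _)))
    (∈-cartesianProductWith⁺ node′
      (complete f t₁ (ℕ.≤-trans (ℕ.m≤m+n _ _) (s≤s⁻¹ ≤f)))
      (subst (λ m → t₂ ∈ enumerate f m) (sym (ℕ.m+n∸m≡n (#nodes t₁) (#nodes t₂)))
        (complete f t₂ (ℕ.≤-trans (ℕ.m≤n+m _ _) (s≤s⁻¹ ≤f))))))

complete′ : ∀ {n} t → #nodes t ≡ n → t ∈ enumerate n n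
complete′ t refl = complete (#nodes t) t ℕ.≤-refl

unique : ∀ f n → Unique (enumerate f n)
unique _       zero    = All.[] ∷ []
unique zero    (suc n) = []
unique (suc f) (suc n) = Unique.concat⁺
  (All.map⁺ (All.universal (λ i → Unique.cartesianProductWith⁺ node′ (λ { refl → refl , refl }) (unique f i) (unique f (n ℕ.∸ i))) (upTo (suc n))))
  (AllPairs.map⁺ (AllPairs.map disjoint (Unique.upTo⁺ (suc n))))
  where
  disjoint : ∀ {i j} → i ≢ j → ∀ {t} →
    (t ∈ cartesianProductWith node′ (enumerate f i) (enumerate f (n ℕ.∸ i))) ×
    (t ∈ cartesianProductWith node′ (enumerate f j) (enumerate f (n ℕ.∸ j))) → ⊥
  disjoint {i} {j} i≢j (t∈ᵢ , t∈ⱼ)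
    with _ , _ , t₁∈ᵢ , _ , refl ← ∈-cartesianProductWith⁻ node′ (enumerate f i) (enumerate f (n ℕ.∸ i)) t∈ᵢ
    with _ , _ , t₁∈ⱼ , _ , refl ← ∈-cartesianProductWith⁻ node′ (enumerate f j) (enumerate f (n ℕ.∸ j)) t∈ⱼ
    = i≢j (trans (sym (sound f i t₁∈ᵢ)) (sound f j t₁∈ⱼ))

treesOfSize : ∀ n → ∃ λ ts → Unique ts × (∀ t → t ∈ ts ⇔ #nodes t ≡ n)
treesOfSize n = enumerate n n , unique n n , λ t → mk⇔ (sound n n) (complete′ t)

trees : ℕ → List BinaryTree
trees n = proj₁ (treesOfSize n)

private

  comb : ∀ n → ∃ λ (t : BinaryTree) → #nodes t ≡ n
  comb zero    = leaf tt , refl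
  comb (suc n) = node (leaf tt) tt (proj₁ (comb n)) , cong suc (proj₂ (comb n))

  ∈⇒nonZero : ∀ {A : Set} {x : A} {xs} → x ∈ xs → NonZero (length xs)
  ∈⇒nonZero (here _)  = _
  ∈⇒nonZero (there _) = _

trees-nonZero : ∀ n → NonZero (length (trees n))
trees-nonZero n with t , eq ← comb n = ∈⇒nonZero (complete′ t eq)

fromℕ : ℕ → ℚ
fromℕ n = ℚ.fromℤ (ℤ.+ n)

mean : ∀ {A : Set} (xs : List A) .{{_ : NonZero (length xs)}} → (A → ℚ) → ℚ
mean xs X = foldr ℚ._+_ 0ℚ (map X xs) ℚ.* (ℤ.+ 1 ℚ./ length xs)

-- Expectation and variance of X on a uniformly random binary tree of size n.
𝔼 : ℕ → (BinaryTree → ℚ) → ℚ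
𝔼 n X = mean (trees n) {{trees-nonZero n}} X

𝕍 : ℕ → (BinaryTree → ℚ) → ℚ
𝕍 n X = 𝔼 n λ t → (X t ℚ.- 𝔼 n X) ℚ.* (X t ℚ.- 𝔼 n X)

E : ℕ → ℕ → ℚ
E n r = 𝔼 n λ t → fromℕ (#branches r t)

V : ℕ → ℕ → ℚ
V n r = 𝕍 n λ t → fromℕ (#branches r t)

infix 4 _∈O_

_∈O_ : (f g : ℕ → ℚ) → Set
f ∈O g = ∃ λ (C : ℚ) → ∃ λ (n₀ : ℕ) → ∀ n → n₀ ℕ.≤ n → ℚ.∣ f n ∣ ℚ.≤ C ℚ.* ℚ.∣ g n ∣

infix 9 _⁻¹

-- The value at 0 is a convention; it has no influence on asymptotic statements.
_⁻¹ : ℕ → ℚ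
zero  ⁻¹ = 0ℚ
suc n ⁻¹ = ℤ.+ 1 ℚ./ suc n

instance
  ℕ-number = ℕ.number
  ℤ-number = ℤ.number
  ℚ-number = ℚ.number

{-# OPTIONS --safe #-}
module Submission where

-- Pruning a non-leaf tree (removing its leaves and contracting the nodes left with a single child)
-- lowers every register label by one, so it turns (r+1)-branches into r-branches; a tree of size k
-- arises from binom(n,2k) 2^(n-2k) trees of size n + 1. Hence sums over trees evolve in r by the linear
-- operator T a n = ∑ₖ binom(n,2k) 2^(n-2k) aₖ. It acts well on J d k = (2k)!/(k!(k+d)!): T (J d) is a
-- hypergeometric term, so up to an error O(J 4) the span of J 0, …, J 3 is mapped to itself with a shift
-- of the argument (and likewise for k J 0, J 0, J 1, J 2 up to O(J 3)). The coefficients of the first two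
-- moments then satisfy triangular linear recurrences in r, solved by powers of 4, and division by the
-- Catalan number J 1 n, for which J d n / J 1 n = O(n^(1-d)), gives the expansions.

open import Defs
open import Agda.Builtin.FromNat using (fromNat)
open import Data.Rational.Base as ℚ using (ℚ; 0ℚ; _+_; _-_; _*_; _/_; -_; _≤_; _<_; ∣_∣; NonNegative; Positive; +-*-rawSemiring)
open import Algebra.Definitions.RawSemiring +-*-rawSemiring using (_^_)
open import Data.Bool.Base using (Bool; true; false)
import Data.Integer.Base as ℤ
import Data.Integer.Properties as ℤ
open import Data.List.Base using (List; []; _∷_; _++_; map; foldr; length; concatMap; cartesianProductWith; applyUpTo; upTo)
open import Data.List.Membership.Propositional using (_∈_)
open import Data.List.Relation.Unary.Any using (here; there)
open import Data.Nat.Base as ℕ using (ℕ; zero; suc; s≤s)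
import Data.Nat.Properties as ℕ
open import Data.Product.Base using (_×_; _,_; ∃)
import Data.Rational.Properties as ℚ
open import Data.Sum.Base using (inj₁; inj₂)
open import Data.Tree.Binary using (leaf; node; #nodes)
open import Data.Unit.Base using (tt)
open import Function.Base using (_∘_)
open import Relation.Binary.PropositionalEquality using (_≡_; _≗_; refl; sym; trans; cong; cong₂; subst; subst₂; module ≡-Reasoning)
open import Relation.Nullary using (Dec; yes; no; does; contradiction)
open import Relation.Nullary.Decidable using (dec⇒maybe)
open import Tactic.RingSolver using (solve-∀)
open import Tactic.RingSolver.Core.AlmostCommutativeRing using (AlmostCommutativeRing; fromCommutativeRing)

-- The basis comes from Bessel functions: the exponential generating function of `spread (J d)` is
-- f_d(z) = z^(-d) I_d(2z), with I_d the modified Bessel function, and `T` multiplies it by e^(2z).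
-- The recurrences of I_d are what gives T (J d) a closed form. Since J d k grows like 4^k
-- k^(-d-1/2), the weighted terms concentrate near k = n/4, so that T (J d) n is close to 4^(d-1) J
-- d (n+1). As k J 0 k is the member d = -1 of the family, the diagonal entries of the recurrences
-- are 1/16, 1/4, 1, 4, 16; hence the powers of 4. The variance also needs the mean up to O(n^(-3)):
-- the square of the mean is subtracted from the second moment, and its factor of order n costs one
-- power of n in the error, while the terms of order n^2 cancel.

ℚ-ring : AlmostCommutativeRing _ _
ℚ-ring = fromCommutativeRing ℚ.+-*-commutativeRing λ x → dec⇒maybe (0ℚ ℚ.≟ x)

fromℕ-+ : ∀ m n → fromℕ (m ℕ.+ n) ≡ fromℕ m + fromℕ n
fromℕ-+ m n = trans (sym (ℚ.fromℚᵘ-toℚᵘ (fromℕ (m ℕ.+ n))))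
  (cong (_/ 1) (sym (cong₂ ℤ._+_ (ℤ.*-identityʳ (ℤ.+ m)) (ℤ.*-identityʳ (ℤ.+ n)))))

fromℕ-suc : ∀ n → fromℕ (suc n) ≡ fromℕ n + 1
fromℕ-suc n = trans (cong fromℕ (sym (ℕ.+-comm n 1))) (fromℕ-+ n 1)

+-interchange : ∀ a b c d → (a + b) + (c + d) ≡ (a + c) + (b + d)
+-interchange = solve-∀ ℚ-ring

-- Sums over lists and over the trees of a given size

module _ {A : Set} where

  Σ : List A → (A → ℚ) → ℚ
  Σ xs X = foldr _+_ 0ℚ (map X xs)

  Σ-cong-∈ : ∀ xs {X Y : A → ℚ} → (∀ {x} → x ∈ xs → X x ≡ Y x) → Σ xs X ≡ Σ xs Y
  Σ-cong-∈ []       X≡Y = refl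
  Σ-cong-∈ (x ∷ xs) X≡Y = cong₂ _+_ (X≡Y (here refl)) (Σ-cong-∈ xs (X≡Y ∘ there))

  Σ-cong : ∀ xs {X Y : A → ℚ} → X ≗ Y → Σ xs X ≡ Σ xs Y
  Σ-cong xs X≡Y = Σ-cong-∈ xs λ {x} _ → X≡Y x

  Σ-++ : ∀ xs ys (X : A → ℚ) → Σ (xs ++ ys) X ≡ Σ xs X + Σ ys X
  Σ-++ []       ys X = sym (ℚ.+-identityˡ _)
  Σ-++ (x ∷ xs) ys X = trans (cong (X x +_) (Σ-++ xs ys X)) (sym (ℚ.+-assoc (X x) _ _))

  Σ-+ : ∀ xs (X Y : A → ℚ) → Σ xs (λ x → X x + Y x) ≡ Σ xs X + Σ xs Y
  Σ-+ []       X Y = refl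
  Σ-+ (x ∷ xs) X Y = trans (cong (X x + Y x +_) (Σ-+ xs X Y)) (+-interchange (X x) (Y x) _ _)

  Σ-* : ∀ xs c (X : A → ℚ) → Σ xs (λ x → c * X x) ≡ c * Σ xs X
  Σ-* []       c X = sym (ℚ.*-zeroʳ c)
  Σ-* (x ∷ xs) c X = trans (cong (c * X x +_) (Σ-* xs c X)) (sym (ℚ.*-distribˡ-+ c _ _))

  Σ-1 : ∀ (xs : List A) → Σ xs (λ _ → 1) ≡ fromℕ (length xs)
  Σ-1 []       = refl
  Σ-1 (x ∷ xs) = trans (cong (1 +_) (Σ-1 xs)) (sym (fromℕ-+ 1 (length xs)))

  -- Stated for an abstract additive `L`, so that the value of `T` at a fixed point can be taken out
  -- of a sum over trees without writing `T` as an explicit sum.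
  Σ-functional : ∀ {I : Set} (L : (I → ℚ) → ℚ) → (L (λ _ → 0ℚ) ≡ 0ℚ) →
    (∀ a b → L (λ i → a i + b i) ≡ L a + L b) →
    ∀ xs (F : A → I → ℚ) → Σ xs (λ x → L (F x)) ≡ L (λ i → Σ xs (λ x → F x i))
  Σ-functional L L-0 L-+ []       F = sym L-0
  Σ-functional L L-0 L-+ (x ∷ xs) F =
    trans (cong (L (F x) +_) (Σ-functional L L-0 L-+ xs F)) (sym (L-+ (F x) _))

Σ-map : ∀ {A B : Set} (f : A → B) xs (X : B → ℚ) → Σ (map f xs) X ≡ Σ xs (X ∘ f)
Σ-map f []       X = refl
Σ-map f (x ∷ xs) X = cong (X (f x) +_) (Σ-map f xs X)

Σ-concatMap : ∀ {A B : Set} (f : A → List B) xs (X : B → ℚ) → Σ (concatMap f xs) X ≡ Σ xs (λ x → Σ (f x) X)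
Σ-concatMap f []       X = refl
Σ-concatMap f (x ∷ xs) X = trans (Σ-++ (f x) _ X) (cong (Σ (f x) X +_) (Σ-concatMap f xs X))

Σ-cartesianProductWith : ∀ {A B C : Set} (f : A → B → C) xs ys (X : C → ℚ) →
  Σ (cartesianProductWith f xs ys) X ≡ Σ xs (λ x → Σ ys (λ y → X (f x y)))
Σ-cartesianProductWith f []       ys X = refl
Σ-cartesianProductWith f (x ∷ xs) ys X =
  trans (Σ-++ (map (f x) ys) _ X) (cong₂ _+_ (Σ-map (f x) ys X) (Σ-cartesianProductWith f xs ys X))

-- D n F is the sum of F i j over i + j = n.
D : ℕ → (ℕ → ℕ → ℚ) → ℚ
D zero    F = F 0 0
D (suc n) F = F 0 (suc n) + D n (F ∘ suc)

D-cong : ∀ n {F G} → (∀ i j → i ℕ.+ j ≡ n → F i j ≡ G i j) → D n F ≡ D n G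
D-cong zero    F≡G = F≡G 0 0 refl
D-cong (suc n) F≡G = cong₂ _+_ (F≡G 0 (suc n) refl) (D-cong n λ i j eq → F≡G (suc i) j (cong suc eq))

D-last : ∀ n F → D (suc n) F ≡ D n (λ i j → F i (suc j)) + F (suc n) 0
D-last zero    F = refl
D-last (suc n) F = trans (cong (F 0 (suc (suc n)) +_) (D-last n (F ∘ suc))) (sym (ℚ.+-assoc (F 0 (suc (suc n))) _ _))

D-+ : ∀ n F G → D n (λ i j → F i j + G i j) ≡ D n F + D n G
D-+ zero    F G = refl
D-+ (suc n) F G = trans (cong (F 0 (suc n) + G 0 (suc n) +_) (D-+ n (F ∘ suc) (G ∘ suc)))
  (+-interchange (F 0 (suc n)) (G 0 (suc n)) _ _)

D-* : ∀ n c F → D n (λ i j → c * F i j) ≡ c * D n F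
D-* zero    c F = refl
D-* (suc n) c F = trans (cong (c * F 0 (suc n) +_) (D-* n c (F ∘ suc))) (sym (ℚ.*-distribˡ-+ c _ _))

-- The function `f` is arbitrary so that the induction can pass to `f ∘ suc`, with `F` becoming
-- `F ∘ suc`.
Σ-applyUpTo : ∀ n {A : Set} (f : ℕ → A) X {F} → (∀ i → X (f i) ≡ F i (n ℕ.∸ i)) → Σ (applyUpTo f (suc n)) X ≡ D n F
Σ-applyUpTo zero    f X X≡F = trans (ℚ.+-identityʳ _) (X≡F 0)
Σ-applyUpTo (suc n) f X X≡F = cong₂ _+_ (X≡F 0) (Σ-applyUpTo n (f ∘ suc) X (X≡F ∘ suc))

Σ-enumerate : ∀ f n X → Σ (enumerate (suc f) (suc n)) X ≡
  D n (λ i j → Σ (enumerate f i) λ t₁ → Σ (enumerate f j) λ t₂ → X (node′ t₁ t₂))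
Σ-enumerate f n X = trans (Σ-concatMap row (upTo (suc n)) X) (Σ-applyUpTo n (λ i → i) (λ i → Σ (row i) X)
  λ i → Σ-cartesianProductWith node′ (enumerate f i) (enumerate f (n ℕ.∸ i)) X)
  where
  row : ℕ → List BinaryTree
  row i = cartesianProductWith node′ (enumerate f i) (enumerate f (n ℕ.∸ i))

-- In `enumerate` the subtrees inherit the fuel of the whole tree, while `trees i` uses the fuel
-- `i`. Any sufficient fuel gives the same sums, which makes the decomposition `𝒮-suc` by subtree
-- sizes possible.
Σ-enumerate-fuel : ∀ f g n X → n ℕ.≤ f → n ℕ.≤ g → Σ (enumerate f n) X ≡ Σ (enumerate g n) X
Σ-enumerate-fuel f       g       zero    X _         _         = refl
Σ-enumerate-fuel (suc f) (suc g) (suc n) X (s≤s n≤f) (s≤s n≤g) = begin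
  Σ (enumerate (suc f) (suc n)) X                                                           ≡⟨ Σ-enumerate f n X ⟩
  D n (λ i j → Σ (enumerate f i) λ t₁ → Σ (enumerate f j) λ t₂ → X (node′ t₁ t₂))           ≡⟨ D-cong n same ⟩
  D n (λ i j → Σ (enumerate g i) λ t₁ → Σ (enumerate g j) λ t₂ → X (node′ t₁ t₂))           ≡⟨ Σ-enumerate g n X ⟨
  Σ (enumerate (suc g) (suc n)) X                                                           ∎
  where
  open ≡-Reasoning
  same : ∀ i j → i ℕ.+ j ≡ n → _ ≡ _
  same i j refl = trans
    (Σ-enumerate-fuel f g i _ (ℕ.m+n≤o⇒m≤o i n≤f) (ℕ.m+n≤o⇒m≤o i n≤g))
    (Σ-cong (enumerate g i) λ t₁ → Σ-enumerate-fuel f g j _ (ℕ.m+n≤o⇒n≤o i n≤f) (ℕ.m+n≤o⇒n≤o i n≤g))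

𝒮 : ℕ → (BinaryTree → ℚ) → ℚ
𝒮 n = Σ (trees n)

𝒮-cong : ∀ n {X Y} → (∀ t → #nodes t ≡ n → X t ≡ Y t) → 𝒮 n X ≡ 𝒮 n Y
𝒮-cong n X≡Y = Σ-cong-∈ (trees n) λ {t} t∈ → X≡Y t (sound n n t∈)

𝒮-suc : ∀ n X → 𝒮 (suc n) X ≡ D n (λ i j → 𝒮 i λ t₁ → 𝒮 j λ t₂ → X (node′ t₁ t₂))
𝒮-suc n X = trans (Σ-enumerate n n X) (D-cong n λ { i j refl → trans
  (Σ-enumerate-fuel n i i _ (ℕ.m≤m+n i j) ℕ.≤-refl)
  (Σ-cong (trees i) λ t₁ → Σ-enumerate-fuel n j j _ (ℕ.m≤n+m j i) ℕ.≤-refl) })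

-- Pruning the leaves of a tree

-- The value at a leaf is a convention, chosen so that an inner node with two leaf children becomes
-- a leaf.
prune : BinaryTree → BinaryTree
prune (leaf _)                               = leaf tt
prune (node (leaf _) _ t₂)                   = prune t₂
prune (node t₁@(node _ _ _) _ (leaf _))      = prune t₁
prune (node t₁@(node _ _ _) _ t₂@(node _ _ _)) = node′ (prune t₁) (prune t₂)

prune-leafʳ : ∀ t → prune (node′ t (leaf tt)) ≡ prune t
prune-leafʳ (leaf _)     = refl
prune-leafʳ (node _ _ _) = refl

combine-suc : ∀ a b → combine (suc a) (suc b) ≡ suc (combine a b)
combine-suc a b with a ℕ.≟ b | suc a ℕ.≟ suc b
... | yes _   | yes _  = refl
... | yes a≡b | no ≢   = contradiction (cong suc a≡b) ≢
... | no a≢b  | yes ≡  = contradiction (ℕ.suc-injective ≡) a≢b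
... | no _    | no _   = refl

-- A leaf next to an inner node does not change the positive label passed upwards, so contracting
-- the parent is harmless; at a node with two inner children `combine` commutes with `suc`.
Reg-prune : ∀ t₁ t₂ → Reg (node t₁ tt t₂) ≡ suc (Reg (prune (node t₁ tt t₂)))
Reg-prune (leaf _) (leaf _) = refl
Reg-prune (leaf _) t@(node t₁ _ t₂) rewrite Reg-prune t₁ t₂ = refl
Reg-prune t@(node t₁ _ t₂) (leaf _) rewrite Reg-prune t₁ t₂ = refl
Reg-prune t@(node t₁ _ t₂) t′@(node t₁′ _ t₂′) rewrite Reg-prune t₁ t₂ | Reg-prune t₁′ t₂′ =
  combine-suc (Reg (prune t)) (Reg (prune t′))

-- The decisions of `suc a ≡ suc r` and `a ≡ r` concern different propositions, but their Booleans
-- agree by computation; hence the passage from `starts` to Booleans.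
newBranch : Bool → Bool → Bool → ℕ
newBranch true false false = 1
newBranch _    _     _     = 0

starts-does : ∀ {r a b c : ℕ} (a? : Dec (a ≡ r)) (b? : Dec (b ≡ r)) (c? : Dec (c ≡ r)) →
  starts a? b? c? ≡ newBranch (does a?) (does b?) (does c?)
starts-does (yes _) (yes _) _       = refl
starts-does (yes _) (no _)  (yes _) = refl
starts-does (yes _) (no _)  (no _)  = refl
starts-does (no _)  _       _       = refl

startsAt : (r a b c : ℕ) → ℕ
startsAt r a b c = starts (a ℕ.≟ r) (b ℕ.≟ r) (c ℕ.≟ r)

startsAt-suc : ∀ r {A B C a b c} → A ≡ suc a → B ≡ suc b → C ≡ suc c → startsAt (suc r) A B C ≡ startsAt r a b c
startsAt-suc r {a = a} {b} {c} refl refl refl = trans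
  (starts-does (suc a ℕ.≟ suc r) (suc b ℕ.≟ suc r) (suc c ℕ.≟ suc r))
  (sym (starts-does (a ℕ.≟ r) (b ℕ.≟ r) (c ℕ.≟ r)))

startsAt-left : ∀ r a c → startsAt r a a c ≡ 0
startsAt-left r a c with a ℕ.≟ r
... | yes _ = refl
... | no _  = refl

startsAt-right : ∀ r a b → startsAt r a b a ≡ 0
startsAt-right r a b with a ℕ.≟ r | b ℕ.≟ r
... | yes _ | yes _ = refl
... | yes _ | no _  = refl
... | no _  | _     = refl

Reg-leafˡ : ∀ t₁ t₂ → Reg (node′ (leaf tt) (node′ t₁ t₂)) ≡ Reg (node′ t₁ t₂)
Reg-leafˡ t₁ t₂ = trans (Reg-prune (leaf tt) (node′ t₁ t₂)) (sym (Reg-prune t₁ t₂))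

Reg-leafʳ : ∀ t₁ t₂ → Reg (node′ (node′ t₁ t₂) (leaf tt)) ≡ Reg (node′ t₁ t₂)
Reg-leafʳ t₁ t₂ = trans (Reg-prune (node′ t₁ t₂) (leaf tt)) (sym (Reg-prune t₁ t₂))

-- A contracted node has the label of its inner child, so it prolongs a branch and starts none;
-- removed leaves have label 0 and lie on no (r+1)-branch. At all other nodes the three labels
-- compared by `starts` drop by one.
branchCount-prune : ∀ r t₁ t₂ → branchCount (suc r) (node′ t₁ t₂) ≡ branchCount r (prune (node′ t₁ t₂))
branchCount-prune zero    (leaf _) (leaf _) = refl
branchCount-prune (suc r) (leaf _) (leaf _) = refl
branchCount-prune r (leaf _) t@(node t₁ _ t₂) = cong₂ ℕ._+_
  (trans (cong (λ a → startsAt (suc r) a 0 (Reg t)) (Reg-leafˡ t₁ t₂)) (startsAt-right (suc r) (Reg t) 0))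
  (branchCount-prune r t₁ t₂)
branchCount-prune r t@(node t₁ _ t₂) (leaf _) = cong₂ ℕ._+_
  (trans (cong (λ a → startsAt (suc r) a (Reg t) 0) (Reg-leafʳ t₁ t₂)) (startsAt-left (suc r) (Reg t) 0))
  (trans (ℕ.+-identityʳ _) (branchCount-prune r t₁ t₂))
branchCount-prune r t@(node t₁ _ t₂) t′@(node t₁′ _ t₂′) = cong₂ ℕ._+_
  (startsAt-suc r (Reg-prune t t′) (Reg-prune t₁ t₂) (Reg-prune t₁′ t₂′))
  (cong₂ ℕ._+_ (branchCount-prune r t₁ t₂) (branchCount-prune r t₁′ t₂′))

-- Inner nodes have positive labels by `Reg-prune`, so every leaf is a 0-branch by itself, and there
-- is one more leaf than inner nodes.
branchCount-zero : ∀ t → branchCount 0 t ≡ suc (#nodes t)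
branchCount-zero (leaf _) = refl
branchCount-zero (node t₁ _ t₂) = cong₂ ℕ._+_
  (cong (λ a → startsAt 0 a (Reg t₁) (Reg t₂)) (Reg-prune t₁ t₂))
  (cong₂ ℕ._+_ (branchCount-zero t₁) (branchCount-zero t₂))

-- Binomial transform, convolutions and the operator T

-- H n a = ∑ₘ binom(n,m) 2^(n-m) aₘ, that is, the value at 0 of (2 + shift)ⁿ a.
H : ℕ → (ℕ → ℚ) → ℚ
H zero    a = a 0
H (suc n) a = 2 * H n a + H n (a ∘ suc)

H-cong-≤ : ∀ n {a b} → (∀ m → m ℕ.≤ n → a m ≡ b m) → H n a ≡ H n b
H-cong-≤ zero    a≡b = a≡b 0 ℕ.z≤n
H-cong-≤ (suc n) a≡b = cong₂ _+_
  (cong (2 *_) (H-cong-≤ n λ m m≤n → a≡b m (ℕ.m≤n⇒m≤1+n m≤n)))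
  (H-cong-≤ n λ m m≤n → a≡b (suc m) (s≤s m≤n))

H-cong : ∀ n {a b} → a ≗ b → H n a ≡ H n b
H-cong n a≡b = H-cong-≤ n λ m _ → a≡b m

H-0 : ∀ n → H n (λ _ → 0ℚ) ≡ 0ℚ
H-0 zero    = refl
H-0 (suc n) rewrite H-0 n = refl

H-+ : ∀ n a b → H n (λ m → a m + b m) ≡ H n a + H n b
H-+ zero    a b = refl
H-+ (suc n) a b = trans
  (cong₂ (λ p q → 2 * p + q) (H-+ n a b) (H-+ n (a ∘ suc) (b ∘ suc)))
  (regroup (H n a) (H n b) (H n (a ∘ suc)) (H n (b ∘ suc)))
  where
  regroup : ∀ p q p′ q′ → 2 * (p + q) + (p′ + q′) ≡ (2 * p + p′) + (2 * q + q′)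
  regroup = solve-∀ ℚ-ring

H-* : ∀ n c a → H n (λ m → c * a m) ≡ c * H n a
H-* zero    c a = refl
H-* (suc n) c a = trans
  (cong₂ (λ p q → 2 * p + q) (H-* n c a) (H-* n c (a ∘ suc)))
  (regroup c (H n a) (H n (a ∘ suc)))
  where
  regroup : ∀ c p q → 2 * (c * p) + c * q ≡ c * (2 * p + q)
  regroup = solve-∀ ℚ-ring

-- Multiplication of a generating function by its variable. It also represents an empty sum at 0,
-- since `D` always has at least one term.
shift : (ℕ → ℚ) → ℕ → ℚ
shift a zero    = 0ℚ
shift a (suc m) = a m

D-shift : ∀ m b → D m b ≡ b 0 m + shift (λ m → D m (b ∘ suc)) m
D-shift zero    b = sym (ℚ.+-identityʳ (b 0 0))
D-shift (suc m) b = refl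

-- In generating functions: the product of zᵏ/(1-2z)ᵏ⁺¹ and zˡ/(1-2z)ˡ⁺¹ is zᵏ⁺ˡ/(1-2z)ᵏ⁺ˡ⁺².
H-convolution : ∀ n b → D n (λ i j → H i λ k → H j λ l → b k l) ≡ H (suc n) (shift λ m → D m b)
H-convolution zero    b = sym (ℚ.+-identityˡ (b 0 0))
H-convolution (suc n) b = begin
  H (suc n) (b 0) + D n (λ i j → 2 * H i (λ k → H j (b k)) + H i (λ k → H j (b (suc k))))
    ≡⟨ cong (H (suc n) (b 0) +_) (trans (D-+ n _ _) (cong (_+ rest) (D-* n 2 _))) ⟩
  H (suc n) (b 0) + (2 * D n (λ i j → H i λ k → H j (b k)) + rest)
    ≡⟨ cong₂ (λ p q → H (suc n) (b 0) + (2 * p + q)) (H-convolution n b) (H-convolution n (b ∘ suc)) ⟩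
  H (suc n) (b 0) + (2 * H (suc n) (shift λ m → D m b) + H (suc n) (shift λ m → D m (b ∘ suc)))
    ≡⟨ regroup (H (suc n) (b 0)) (H (suc n) (shift λ m → D m b)) _ ⟩
  2 * H (suc n) (shift λ m → D m b) + (H (suc n) (b 0) + H (suc n) (shift λ m → D m (b ∘ suc)))
    ≡⟨ cong (2 * H (suc n) (shift λ m → D m b) +_) (trans (H-cong (suc n) λ m → D-shift m b) (H-+ (suc n) (b 0) _)) ⟨
  2 * H (suc n) (shift λ m → D m b) + H (suc n) (λ m → D m b) ∎
  where
  open ≡-Reasoning
  rest : ℚ
  rest = D n (λ i j → H i λ k → H j (b (suc k)))
  regroup : ∀ p q r → p + (2 * q + r) ≡ 2 * q + (p + r)
  regroup = solve-∀ ℚ-ring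

-- Substitution of z^2 for z in a generating function; followed by `H` it leaves the weights
-- binom(n,2k) 2^(n-2k).
spread : (ℕ → ℚ) → ℕ → ℚ
spread a zero          = a 0
spread a (suc zero)    = 0ℚ
spread a (suc (suc m)) = spread (a ∘ suc) m

spread-cong-≤ : ∀ m {a b} → (∀ k → k ℕ.≤ m → a k ≡ b k) → spread a m ≡ spread b m
spread-cong-≤ zero          a≡b = a≡b 0 ℕ.z≤n
spread-cong-≤ (suc zero)    a≡b = refl
spread-cong-≤ (suc (suc m)) a≡b = spread-cong-≤ m λ k k≤m → a≡b (suc k) (s≤s (ℕ.m≤n⇒m≤1+n k≤m))

spread-cong : ∀ m {a b} → a ≗ b → spread a m ≡ spread b m
spread-cong m a≡b = spread-cong-≤ m λ k _ → a≡b k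

spread-0 : ∀ m → spread (λ _ → 0ℚ) m ≡ 0ℚ
spread-0 zero          = refl
spread-0 (suc zero)    = refl
spread-0 (suc (suc m)) = spread-0 m

spread-+ : ∀ m a b → spread (λ k → a k + b k) m ≡ spread a m + spread b m
spread-+ zero          a b = refl
spread-+ (suc zero)    a b = refl
spread-+ (suc (suc m)) a b = spread-+ m (a ∘ suc) (b ∘ suc)

spread-* : ∀ m c a → spread (λ k → c * a k) m ≡ c * spread a m
spread-* zero          c a = refl
spread-* (suc zero)    c a = sym (ℚ.*-zeroʳ c)
spread-* (suc (suc m)) c a = spread-* m c (a ∘ suc)

spread-H : ∀ m n (A : ℕ → ℕ → ℚ) → spread (λ k → H n (A k)) m ≡ H n (λ l → spread (λ k → A k l) m)
spread-H zero          n A = refl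
spread-H (suc zero)    n A = sym (H-0 n)
spread-H (suc (suc m)) n A = spread-H m n (A ∘ suc)

-- Substituting z^2 for z commutes with multiplying generating functions.
D-spread : ∀ m b → D m (λ k l → spread (λ k → spread (b k) l) k) ≡ spread (λ q → D q b) m
D-spread zero          b = refl
D-spread (suc zero)    b = refl
D-spread (suc (suc m)) b = begin
  spread (b 0 ∘ suc) m + (0ℚ + D m (λ k l → spread (λ k → spread (b (suc k)) l) k))
    ≡⟨ cong (spread (b 0 ∘ suc) m +_) (trans (ℚ.+-identityˡ _) (D-spread m (b ∘ suc))) ⟩
  spread (b 0 ∘ suc) m + spread (λ q → D q (b ∘ suc)) m
    ≡⟨ spread-+ m (b 0 ∘ suc) _ ⟨
  spread (λ q → b 0 (suc q) + D q (b ∘ suc)) m ∎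
  where open ≡-Reasoning

shift-spread : ∀ m a → spread a (suc m) ≡ shift (spread (a ∘ suc)) m
shift-spread zero    a = refl
shift-spread (suc m) a = refl

H-spread-convolution : ∀ n b →
  D n (λ i j → H i (spread λ k → H j (spread (b k)))) ≡ H (suc n) (shift (spread λ m → D m b))
H-spread-convolution n b = begin
  D n (λ i j → H i (spread λ k → H j (spread (b k))))
    ≡⟨ D-cong n (λ i j _ → H-cong i λ k → spread-H k j (spread ∘ b)) ⟩
  D n (λ i j → H i λ k → H j λ l → spread (λ k → spread (b k) l) k)
    ≡⟨ H-convolution n _ ⟩
  H (suc n) (shift λ m → D m (λ k l → spread (λ k → spread (b k) l) k))
    ≡⟨ H-cong (suc n) (λ { zero → refl ; (suc m) → D-spread m b }) ⟩
  H (suc n) (shift (spread λ m → D m b)) ∎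
  where open ≡-Reasoning

T : (ℕ → ℚ) → ℕ → ℚ
T a n = H n (spread a)

T-cong-≤ : ∀ n {a b} → (∀ m → m ℕ.≤ n → a m ≡ b m) → T a n ≡ T b n
T-cong-≤ n a≡b = H-cong-≤ n λ m m≤n → spread-cong-≤ m λ k k≤m → a≡b k (ℕ.≤-trans k≤m m≤n)

T-cong : ∀ n {a b} → a ≗ b → T a n ≡ T b n
T-cong n a≡b = T-cong-≤ n λ m _ → a≡b m

T-+ : ∀ n a b → T (λ k → a k + b k) n ≡ T a n + T b n
T-+ n a b = trans (H-cong n λ m → spread-+ m a b) (H-+ n (spread a) (spread b))

T-* : ∀ n c a → T (λ k → c * a k) n ≡ c * T a n
T-* n c a = trans (H-cong n λ m → spread-* m c a) (H-* n c (spread a))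

T-0 : ∀ n → T (λ _ → 0ℚ) n ≡ 0ℚ
T-0 n = trans (H-cong n spread-0) (H-0 n)

-- Sums over trees grouped by their pruned tree

prune-node : ∀ {i j} t₁ t₂ → #nodes t₁ ≡ suc i → #nodes t₂ ≡ suc j → prune (node′ t₁ t₂) ≡ node′ (prune t₁) (prune t₂)
prune-node (node _ _ _) (node _ _ _) _ _ = refl

module _ (G : BinaryTree → ℚ) where
  private
    F : ℕ → ℕ → ℚ
    F i j = 𝒮 i λ t₁ → 𝒮 j λ t₂ → G (prune (node′ t₁ t₂))

    left-leaf : ∀ n → F 0 n ≡ 𝒮 n (G ∘ prune)
    left-leaf n = ℚ.+-identityʳ _

    right-leaf : ∀ n → F n 0 ≡ 𝒮 n (G ∘ prune)
    right-leaf n = Σ-cong (trees n) λ t → trans (ℚ.+-identityʳ _) (cong G (prune-leafʳ t))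

    -- The extreme terms of the convolution are the trees with a leaf as left or right subtree; each
    -- of the two gives the sum for size n + 1, whence the factor 2. The terms between them have two
    -- inner subtrees, of which there are none for size 2.
    inner : ∀ n → 𝒮 (suc (suc n)) (G ∘ prune) ≡ 2 * 𝒮 (suc n) (G ∘ prune) + shift (λ m → D m λ i j → F (suc i) (suc j)) n
    inner zero = trans (𝒮-suc 1 (G ∘ prune)) (trans (cong₂ _+_ (left-leaf 1) (right-leaf 1)) (double (𝒮 1 (G ∘ prune))))
      where
      double : ∀ p → p + p ≡ 2 * p + 0ℚ
      double = solve-∀ ℚ-ring
    inner (suc n) = begin
      𝒮 (3 ℕ.+ n) (G ∘ prune)                        ≡⟨ 𝒮-suc (2 ℕ.+ n) (G ∘ prune) ⟩
      F 0 (2 ℕ.+ n) + D (suc n) (F ∘ suc)             ≡⟨ cong (F 0 (2 ℕ.+ n) +_) (D-last n (F ∘ suc)) ⟩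
      F 0 (2 ℕ.+ n) + (mid + F (2 ℕ.+ n) 0)
        ≡⟨ cong₂ (λ p q → p + (mid + q)) (left-leaf (2 ℕ.+ n)) (right-leaf (2 ℕ.+ n)) ⟩
      p + (mid + p)                                   ≡⟨ regroup p mid ⟩
      2 * p + mid                                     ∎
      where
      open ≡-Reasoning
      p mid : ℚ
      p = 𝒮 (2 ℕ.+ n) (G ∘ prune)
      mid = D n (λ i j → F (suc i) (suc j))
      regroup : ∀ p q → p + (q + p) ≡ 2 * p + q
      regroup = solve-∀ ℚ-ring

  prune-step : ∀ n → 𝒮 (suc (suc n)) (G ∘ prune) ≡
    2 * 𝒮 (suc n) (G ∘ prune)
    + shift (λ m → D m λ i j → 𝒮 (suc i) λ t₁ → 𝒮 (suc j) λ t₂ → G (node′ (prune t₁) (prune t₂))) n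
  prune-step n = trans (inner n) (cong (2 * 𝒮 (suc n) (G ∘ prune) +_) (shifted n))
    where
    shifted : ∀ n → shift (λ m → D m λ i j → F (suc i) (suc j)) n ≡ shift (λ m → D m λ i j → _) n
    shifted zero    = refl
    shifted (suc n) = D-cong n λ i j _ → 𝒮-cong (suc i) λ t₁ p → 𝒮-cong (suc j) λ t₂ q → cong G (prune-node t₁ t₂ p q)

𝒮-T : ∀ n k (b : BinaryTree → ℕ → ℚ) → 𝒮 k (λ s → T (b s) n) ≡ T (λ l → 𝒮 k λ s → b s l) n
𝒮-T n k b = Σ-functional (λ a → T a n) (T-0 n) (T-+ n) (trees k) b

-- A tree with k inner nodes has binom(n,2k) 2^(n-2k) preimages with n + 1 inner nodes under prune.
𝒮-prune : ∀ n G → 𝒮 (suc n) (G ∘ prune) ≡ T (λ k → 𝒮 k G) n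
𝒮-prune n G = below (suc n) n (ℕ.n<1+n n) G
  where
  open ≡-Reasoning
  -- Strong induction with `G` quantified: one subtree is pruned with the other one fixed, then the
  -- other with a functional that already contains `T`.
  below : ∀ N n → n ℕ.< N → ∀ G → 𝒮 (suc n) (G ∘ prune) ≡ T (λ k → 𝒮 k G) n
  below N       zero    _         G = refl
  below (suc N) (suc n) (s≤s n<N) G = begin
    𝒮 (2 ℕ.+ n) (G ∘ prune)                                          ≡⟨ prune-step G n ⟩
    2 * 𝒮 (suc n) (G ∘ prune) + shift (λ m → D m λ i j → P i j) n
      ≡⟨ cong₂ (λ p q → 2 * p + q) (below N n n<N G) (pairs n n<N) ⟩
    2 * T (λ k → 𝒮 k G) n + H n (spread (λ k → 𝒮 k G) ∘ suc)         ∎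
    where
    P : ℕ → ℕ → ℚ
    P i j = 𝒮 (suc i) λ t₁ → 𝒮 (suc j) λ t₂ → G (node′ (prune t₁) (prune t₂))
    b : ℕ → ℕ → ℚ
    b k l = 𝒮 k λ s₁ → 𝒮 l λ s₂ → G (node′ s₁ s₂)
    pair : ∀ i j → i ℕ.< N → j ℕ.< N → P i j ≡ T (λ k → T (b k) j) i
    pair i j i<N j<N = begin
      P i j
        ≡⟨ Σ-cong (trees (suc i)) (λ t₁ → below N j j<N (λ s₂ → G (node′ (prune t₁) s₂))) ⟩
      𝒮 (suc i) (λ t₁ → T (λ l → 𝒮 l λ s₂ → G (node′ (prune t₁) s₂)) j)
        ≡⟨ below N i i<N (λ s₁ → T (λ l → 𝒮 l λ s₂ → G (node′ s₁ s₂)) j) ⟩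
      T (λ k → 𝒮 k λ s₁ → T (λ l → 𝒮 l λ s₂ → G (node′ s₁ s₂)) j) i
        ≡⟨ T-cong i (λ k → 𝒮-T j k (λ s₁ l → 𝒮 l λ s₂ → G (node′ s₁ s₂))) ⟩
      T (λ k → T (b k) j) i                                                   ∎
    -- This sum must match the second summand in the recursion of `H`: images with k + 1 inner nodes
    -- are split by the sizes of their two subtrees through `𝒮-suc`.
    pairs : ∀ n → n ℕ.< N → shift (λ m → D m P) n ≡ H n (spread (λ k → 𝒮 k G) ∘ suc)
    pairs zero    _   = refl
    pairs (suc n) n<N = begin
      D n P                                         ≡⟨ D-cong n (λ { i j refl → pair i j
        (ℕ.<-trans (s≤s (ℕ.m≤m+n i j)) n<N) (ℕ.<-trans (s≤s (ℕ.m≤n+m j i)) n<N) }) ⟩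
      D n (λ i j → T (λ k → T (b k) j) i)           ≡⟨ H-spread-convolution n b ⟩
      H (suc n) (shift (spread λ m → D m b))
        ≡⟨ H-cong (suc n) (λ m → trans (shift-spread m (λ k → 𝒮 k G)) (shift-cong m)) ⟨
      H (suc n) (spread (λ k → 𝒮 k G) ∘ suc)        ∎
      where
      shift-cong : ∀ m → shift (spread λ k → 𝒮 (suc k) G) m ≡ shift (spread λ m → D m b) m
      shift-cong zero    = refl
      shift-cong (suc m) = spread-cong m λ k → 𝒮-suc k G

-- Factors linear in the index

⁻¹-inverseˡ : ∀ n → suc n ⁻¹ * fromℕ (suc n) ≡ 1
⁻¹-inverseˡ n = trans (cong (_* fromℕ (suc n)) (ℚ.fromℚᵘ-toℚᵘ (ℚ.1/ fromℕ (suc n)))) (ℚ.*-inverseˡ (fromℕ (suc n)))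

cancel-pos : ∀ {p a b} → 0ℚ ℚ.< p → p * a ≡ p * b → a ≡ b
cancel-pos {p} 0<p pa≡pb = ℚ.≤-antisym
  (ℚ.*-cancelˡ-≤-pos p {{ℚ.positive 0<p}} (ℚ.≤-reflexive pa≡pb))
  (ℚ.*-cancelˡ-≤-pos p {{ℚ.positive 0<p}} (ℚ.≤-reflexive (sym pa≡pb)))

0≤fromℕ : ∀ n → 0ℚ ℚ.≤ fromℕ n
0≤fromℕ n = ℚ.nonNegative⁻¹ (fromℕ n)

0<fromℕ+ : ∀ n p .{{_ : ℚ.Positive p}} → 0ℚ ℚ.< fromℕ n + p
0<fromℕ+ n p = ℚ.+-mono-≤-< (0≤fromℕ n) (ℚ.positive⁻¹ p)

-- Multiplication of an exponential generating function by its variable.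
lower : (ℕ → ℚ) → ℕ → ℚ
lower a zero    = 0ℚ
lower a (suc m) = fromℕ (suc m) * a m

lower-suc : ∀ a m → lower a (suc m) ≡ a m + lower (a ∘ suc) m
lower-suc a zero    = trans (ℚ.*-identityˡ (a 0)) (sym (ℚ.+-identityʳ (a 0)))
lower-suc a (suc m) = trans (cong (_* a (suc m)) (fromℕ-suc (suc m))) (expand (fromℕ (suc m)) (a (suc m)))
  where
  expand : ∀ p q → (p + 1) * q ≡ q + p * q
  expand = solve-∀ ℚ-ring

-- This is m binom(n+1,m) = (n+1) binom(n,m-1), summed with the weights 2^(n+1-m).
H-lower : ∀ n a → H (suc n) (lower a) ≡ fromℕ (suc n) * H n a
H-lower zero    a = ℚ.+-identityˡ _
H-lower (suc n) a = begin
  2 * H (suc n) (lower a) + H (suc n) (lower a ∘ suc)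
    ≡⟨ cong₂ (λ p q → 2 * p + q) (H-lower n a) (trans (H-cong (suc n) (lower-suc a)) (H-+ (suc n) a _)) ⟩
  2 * (fromℕ (suc n) * H n a) + (H (suc n) a + H (suc n) (lower (a ∘ suc)))
    ≡⟨ cong (λ p → 2 * (fromℕ (suc n) * H n a) + (H (suc n) a + p)) (H-lower n (a ∘ suc)) ⟩
  2 * (fromℕ (suc n) * H n a) + (H (suc n) a + fromℕ (suc n) * H n (a ∘ suc))
    ≡⟨ regroup (fromℕ (suc n)) (H n a) (H n (a ∘ suc)) ⟩
  (fromℕ (suc n) + 1) * H (suc n) a
    ≡⟨ cong (_* H (suc n) a) (fromℕ-suc (suc n)) ⟨
  fromℕ (2 ℕ.+ n) * H (suc n) a ∎
  where
  open ≡-Reasoning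
  regroup : ∀ m p q → 2 * (m * p) + ((2 * p + q) + m * q) ≡ (m + 1) * (2 * p + q)
  regroup = solve-∀ ℚ-ring

-- Only even positions m = 2k contribute. The constant `c` is there for the induction, which moves
-- two positions and replaces it by 2 + c.
spread-index : ∀ m c a → spread (λ k → (2 * fromℕ k + c) * a k) m ≡ (fromℕ m + c) * spread a m
spread-index zero          c a = refl
spread-index (suc zero)    c a = sym (ℚ.*-zeroʳ (1 + c))
spread-index (suc (suc m)) c a = begin
  spread (λ k → (2 * fromℕ (suc k) + c) * a (suc k)) m
    ≡⟨ spread-cong m (λ k → cong (_* a (suc k)) (trans (cong (λ p → 2 * p + c) (fromℕ-suc k)) (assoc (fromℕ k) c))) ⟩
  spread (λ k → (2 * fromℕ k + (2 + c)) * a (suc k)) m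
    ≡⟨ spread-index m (2 + c) (a ∘ suc) ⟩
  (fromℕ m + (2 + c)) * spread (a ∘ suc) m
    ≡⟨ cong (_* spread (a ∘ suc) m) (trans (cong (_+ c) (fromℕ-+ 2 m)) (assoc′ (fromℕ m) c)) ⟨
  (fromℕ (2 ℕ.+ m) + c) * spread (a ∘ suc) m ∎
  where
  open ≡-Reasoning
  assoc : ∀ p c → 2 * (p + 1) + c ≡ 2 * p + (2 + c)
  assoc = solve-∀ ℚ-ring
  assoc′ : ∀ p c → 2 + p + c ≡ p + (2 + c)
  assoc′ = solve-∀ ℚ-ring

-- The sequences J d and their images under T

inverseFactorial : ℕ → ℚ
inverseFactorial zero    = 1
inverseFactorial (suc d) = inverseFactorial d * suc d ⁻¹

-- J d k = (2k)! / (k! (k + d)!), so that J 1 k is the k-th Catalan number.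
J : ℕ → ℕ → ℚ
J d zero    = inverseFactorial d
J d (suc k) = 2 * ((2 * fromℕ k + 1) * J (suc d) k)

-- The denominators differ by the factor k + d + 1. The induction follows the recursion of `J`,
-- which trades a step in `k` for one in `d` and so avoids quotients of factorials.
J-raise : ∀ d k → (fromℕ k + fromℕ d + 1) * J (suc d) k ≡ J d k
J-raise d zero = begin
  (0ℚ + fromℕ d + 1) * (inverseFactorial d * suc d ⁻¹)    ≡⟨ regroup (fromℕ d) (inverseFactorial d) (suc d ⁻¹) ⟩
  inverseFactorial d * (suc d ⁻¹ * (fromℕ d + 1))
    ≡⟨ cong (λ p → inverseFactorial d * (suc d ⁻¹ * p)) (fromℕ-suc d) ⟨
  inverseFactorial d * (suc d ⁻¹ * fromℕ (suc d))         ≡⟨ cong (inverseFactorial d *_) (⁻¹-inverseˡ d) ⟩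
  inverseFactorial d * 1                                  ≡⟨ ℚ.*-identityʳ _ ⟩
  inverseFactorial d                                      ∎
  where
  open ≡-Reasoning
  regroup : ∀ d p q → (0ℚ + d + 1) * (p * q) ≡ p * (q * (d + 1))
  regroup = solve-∀ ℚ-ring
J-raise d (suc k) = begin
  (fromℕ (suc k) + fromℕ d + 1) * (2 * ((2 * fromℕ k + 1) * J (2 ℕ.+ d) k))
    ≡⟨ cong (λ p → (p + fromℕ d + 1) * (2 * ((2 * fromℕ k + 1) * J (2 ℕ.+ d) k))) (fromℕ-suc k) ⟩
  (fromℕ k + 1 + fromℕ d + 1) * (2 * ((2 * fromℕ k + 1) * J (2 ℕ.+ d) k))
    ≡⟨ regroup (fromℕ k) (fromℕ d) (J (2 ℕ.+ d) k) ⟩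
  2 * ((2 * fromℕ k + 1) * ((fromℕ k + (fromℕ d + 1) + 1) * J (2 ℕ.+ d) k))
    ≡⟨ cong (λ p → 2 * ((2 * fromℕ k + 1) * ((fromℕ k + p + 1) * J (2 ℕ.+ d) k))) (fromℕ-suc d) ⟨
  2 * ((2 * fromℕ k + 1) * ((fromℕ k + fromℕ (suc d) + 1) * J (2 ℕ.+ d) k))
    ≡⟨ cong (λ p → 2 * ((2 * fromℕ k + 1) * p)) (J-raise (suc d) k) ⟩
  2 * ((2 * fromℕ k + 1) * J (suc d) k) ∎
  where
  open ≡-Reasoning
  regroup : ∀ k d p → (k + 1 + d + 1) * (2 * ((2 * k + 1) * p)) ≡ 2 * ((2 * k + 1) * ((k + (d + 1) + 1) * p))
  regroup = solve-∀ ℚ-ring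

-- In exponential generating functions: f_d' = 2 z f_(d+1) for f_d(z) = z^(-d) I_d(2z).
spread-J : ∀ d m → spread (J d) (suc m) ≡ 2 * lower (spread (J (suc d))) m
spread-J d zero    = refl
spread-J d (suc m) = begin
  spread (λ k → 2 * ((2 * fromℕ k + 1) * J (suc d) k)) m    ≡⟨ spread-* m 2 _ ⟩
  2 * spread (λ k → (2 * fromℕ k + 1) * J (suc d) k) m      ≡⟨ cong (2 *_) (spread-index m 1 (J (suc d))) ⟩
  2 * ((fromℕ m + 1) * spread (J (suc d)) m)
    ≡⟨ cong (λ p → 2 * (p * spread (J (suc d)) m)) (fromℕ-suc m) ⟨
  2 * (fromℕ (suc m) * spread (J (suc d)) m)                ∎
  where open ≡-Reasoning

h : ℕ → ℕ → ℚ
h d = T (J d)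

private
  g : ℕ → ℕ → ℚ
  g d = shift (λ n → fromℕ (suc n) * h (suc d) n)

-- The product rule for e^(2z) f_d(z); here `g d n` is n times h (d+1) (n-1), the coefficient of z
-- e^(2z) f_(d+1)(z).
h-suc : ∀ d n → h d (suc n) ≡ 2 * h d n + 2 * g d n
h-suc d n = cong (2 * h d n +_) (trans (trans (H-cong n (spread-J d)) (H-* n 2 _)) (cong (2 *_) (lowered n)))
  where
  lowered : ∀ n → H n (lower (spread (J (suc d)))) ≡ g d n
  lowered zero    = refl
  lowered (suc n) = H-lower n (spread (J (suc d)))

mutual
  -- In generating functions this is the three-term recurrence I_d(x) - I_(d+2)(x) = (2 (d+1) / x)
  -- I_(d+1)(x). The induction alternates with `g-raise`, which at n + 1 is this identity at n
  -- multiplied by n + 1.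
  h-raise : ∀ d n → (fromℕ n + 2 * fromℕ d + 2) * h (suc d) n ≡ h d (suc n)
  h-raise d zero = begin
    (0ℚ + 2 * fromℕ d + 2) * J (suc d) 0          ≡⟨ regroup (fromℕ d) (J (suc d) 0) ⟩
    2 * ((0ℚ + fromℕ d + 1) * J (suc d) 0) + 2 * 0ℚ    ≡⟨ cong (λ p → 2 * p + 2 * 0ℚ) (J-raise d 0) ⟩
    2 * J d 0 + 2 * 0ℚ                            ≡⟨ h-suc d 0 ⟨
    h d 1                                         ∎
    where
    open ≡-Reasoning
    regroup : ∀ d p → (0ℚ + 2 * d + 2) * p ≡ 2 * ((0ℚ + d + 1) * p) + 2 * 0ℚ
    regroup = solve-∀ ℚ-ring
  h-raise d (suc n) = begin
    (fromℕ (suc n) + 2 * fromℕ d + 2) * h (suc d) (suc n)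
      ≡⟨ cong₂ (λ p q → (p + 2 * fromℕ d + 2) * q) (fromℕ-suc n) (h-suc (suc d) n) ⟩
    (fromℕ n + 1 + 2 * fromℕ d + 2) * (2 * h (suc d) n + 2 * g (suc d) n)
      ≡⟨ expand (fromℕ n) (fromℕ d) (h (suc d) n) (g (suc d) n) ⟩
    2 * ((fromℕ n + 2 * fromℕ d + 3) * h (suc d) n) + 2 * ((fromℕ n + 2 * (fromℕ d + 1) + 1) * g (suc d) n)
      ≡⟨ cong (λ p → 2 * ((fromℕ n + 2 * fromℕ d + 3) * h (suc d) n) + 2 * ((fromℕ n + 2 * p + 1) * g (suc d) n)) (fromℕ-suc d) ⟨
    2 * ((fromℕ n + 2 * fromℕ d + 3) * h (suc d) n) + 2 * ((fromℕ n + 2 * fromℕ (suc d) + 1) * g (suc d) n)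
      ≡⟨ cong (λ p → 2 * ((fromℕ n + 2 * fromℕ d + 3) * h (suc d) n) + 2 * p) (g-raise (suc d) n) ⟩
    2 * ((fromℕ n + 2 * fromℕ d + 3) * h (suc d) n) + 2 * (fromℕ n * h (suc d) n)
      ≡⟨ collect (fromℕ n) (fromℕ d) (h (suc d) n) ⟩
    2 * ((fromℕ n + 2 * fromℕ d + 2) * h (suc d) n) + 2 * ((fromℕ n + 1) * h (suc d) n)
      ≡⟨ cong₂ (λ p q → 2 * p + 2 * (q * h (suc d) n)) (sym (h-raise d n)) (fromℕ-suc n) ⟨
    2 * h d (suc n) + 2 * (fromℕ (suc n) * h (suc d) n)
      ≡⟨ h-suc d (suc n) ⟨
    h d (2 ℕ.+ n) ∎
    where
    open ≡-Reasoning
    expand : ∀ n d p q → (n + 1 + 2 * d + 2) * (2 * p + 2 * q) ≡ 2 * ((n + 2 * d + 3) * p) + 2 * ((n + 2 * (d + 1) + 1) * q)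
    expand = solve-∀ ℚ-ring
    collect : ∀ n d p → 2 * ((n + 2 * d + 3) * p) + 2 * (n * p) ≡ 2 * ((n + 2 * d + 2) * p) + 2 * ((n + 1) * p)
    collect = solve-∀ ℚ-ring

  g-raise : ∀ d n → (fromℕ n + 2 * fromℕ d + 1) * g d n ≡ fromℕ n * h d n
  g-raise d zero    = trans (ℚ.*-zeroʳ (0ℚ + 2 * fromℕ d + 1)) (sym (ℚ.*-zeroˡ (h d 0)))
  g-raise d (suc n) = begin
    (fromℕ (suc n) + 2 * fromℕ d + 1) * (fromℕ (suc n) * h (suc d) n)
      ≡⟨ cong (λ p → (p + 2 * fromℕ d + 1) * (fromℕ (suc n) * h (suc d) n)) (fromℕ-suc n) ⟩
    (fromℕ n + 1 + 2 * fromℕ d + 1) * (fromℕ (suc n) * h (suc d) n)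
      ≡⟨ regroup (fromℕ n) (fromℕ d) (fromℕ (suc n)) (h (suc d) n) ⟩
    fromℕ (suc n) * ((fromℕ n + 2 * fromℕ d + 2) * h (suc d) n)
      ≡⟨ cong (fromℕ (suc n) *_) (h-raise d n) ⟩
    fromℕ (suc n) * h d (suc n) ∎
    where
    open ≡-Reasoning
    regroup : ∀ n d m p → (n + 1 + 2 * d + 1) * (m * p) ≡ m * ((n + 2 * d + 2) * p)
    regroup = solve-∀ ℚ-ring

-- Eliminating `g` from `h-suc` by `g-raise` leaves a recurrence of first order in n.
h-ratio : ∀ d n → (fromℕ n + 2 * fromℕ d + 1) * h d (suc n) ≡ 2 * (2 * fromℕ n + 2 * fromℕ d + 1) * h d n
h-ratio d n = begin
  (fromℕ n + 2 * fromℕ d + 1) * h d (suc n)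
    ≡⟨ cong ((fromℕ n + 2 * fromℕ d + 1) *_) (h-suc d n) ⟩
  (fromℕ n + 2 * fromℕ d + 1) * (2 * h d n + 2 * g d n)
    ≡⟨ expand (fromℕ n) (fromℕ d) (h d n) (g d n) ⟩
  2 * ((fromℕ n + 2 * fromℕ d + 1) * h d n) + 2 * ((fromℕ n + 2 * fromℕ d + 1) * g d n)
    ≡⟨ cong (λ p → 2 * ((fromℕ n + 2 * fromℕ d + 1) * h d n) + 2 * p) (g-raise d n) ⟩
  2 * ((fromℕ n + 2 * fromℕ d + 1) * h d n) + 2 * (fromℕ n * h d n)
    ≡⟨ collect (fromℕ n) (fromℕ d) (h d n) ⟩
  2 * (2 * fromℕ n + 2 * fromℕ d + 1) * h d n ∎
  where
  open ≡-Reasoning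
  expand : ∀ n d p q → (n + 2 * d + 1) * (2 * p + 2 * q) ≡ 2 * ((n + 2 * d + 1) * p) + 2 * ((n + 2 * d + 1) * q)
  expand = solve-∀ ℚ-ring
  collect : ∀ n d p → 2 * ((n + 2 * d + 1) * p) + 2 * (n * p) ≡ 2 * (2 * n + 2 * d + 1) * p
  collect = solve-∀ ℚ-ring

h-step : ∀ d n →
  (fromℕ n + 2 * fromℕ d + 1) * ((fromℕ n + 2 * fromℕ d + 2) * h (suc d) n) ≡ 2 * (2 * fromℕ n + 2 * fromℕ d + 1) * h d n
h-step d n = trans (cong ((fromℕ n + 2 * fromℕ d + 1) *_) (h-raise d n)) (h-ratio d n)

-- Touchard's identity for Catalan numbers: both sides satisfy the same first-order recurrence and
-- agree at 0.
h₁≡J₁ : ∀ n → h 1 n ≡ J 1 (suc n)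
h₁≡J₁ zero    = refl
h₁≡J₁ (suc n) = cancel-pos (0<fromℕ+ n 3) (begin
  (fromℕ n + 3) * h 1 (suc n)                            ≡⟨ regroup₁ (fromℕ n) (h 1 (suc n)) ⟩
  (fromℕ n + 2 * 1 + 1) * h 1 (suc n)                    ≡⟨ h-ratio 1 n ⟩
  2 * (2 * fromℕ n + 2 * 1 + 1) * h 1 n                  ≡⟨ cong (2 * (2 * fromℕ n + 2 * 1 + 1) *_) (h₁≡J₁ n) ⟩
  2 * (2 * fromℕ n + 2 * 1 + 1) * J 1 (suc n)
    ≡⟨ cong (2 * (2 * fromℕ n + 2 * 1 + 1) *_) (J-raise 1 (suc n)) ⟨
  2 * (2 * fromℕ n + 2 * 1 + 1) * ((fromℕ (suc n) + 1 + 1) * J 2 (suc n))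
    ≡⟨ cong (λ p → 2 * (2 * fromℕ n + 2 * 1 + 1) * ((p + 1 + 1) * J 2 (suc n))) (fromℕ-suc n) ⟩
  2 * (2 * fromℕ n + 2 * 1 + 1) * ((fromℕ n + 1 + 1 + 1) * J 2 (suc n))
    ≡⟨ regroup₂ (fromℕ n) (J 2 (suc n)) ⟩
  (fromℕ n + 3) * (2 * ((2 * (fromℕ n + 1) + 1) * J 2 (suc n)))
    ≡⟨ cong (λ p → (fromℕ n + 3) * (2 * ((2 * p + 1) * J 2 (suc n)))) (fromℕ-suc n) ⟨
  (fromℕ n + 3) * J 1 (2 ℕ.+ n) ∎)
  where
  open ≡-Reasoning
  regroup₁ : ∀ n p → (n + 3) * p ≡ (n + 2 * 1 + 1) * p
  regroup₁ = solve-∀ ℚ-ring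
  regroup₂ : ∀ n p → 2 * (2 * n + 2 * 1 + 1) * ((n + 1 + 1 + 1) * p) ≡ (n + 3) * (2 * ((2 * (n + 1) + 1) * p))
  regroup₂ = solve-∀ ℚ-ring

-- Pruning applied to the constant 1 gives Touchard's recurrence for the number of trees, which with
-- the value at 0 determines the Catalan numbers.
𝒮-1 : ∀ n → 𝒮 n (λ _ → 1) ≡ J 1 n
𝒮-1 n = below (suc n) n (ℕ.n<1+n n)
  where
  below : ∀ N n → n ℕ.< N → 𝒮 n (λ _ → 1) ≡ J 1 n
  below N       zero    _         = refl
  below (suc N) (suc n) (s≤s n<N) = trans (𝒮-prune n (λ _ → 1))
    (trans (T-cong-≤ n λ m m≤n → below N m (ℕ.≤-<-trans m≤n n<N)) (h₁≡J₁ n))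

-- The factor k is half of the position 2k, which `H-lower` absorbs into the binomial coefficient;
-- the tail sum that remains is a difference of values of `T` by the recursion of `H`.
T-index : ∀ n a → T (λ k → fromℕ k * a k) (suc n) ≡ (1 / 2) * (fromℕ (suc n) * (T a (suc n) - 2 * T a n))
T-index n a = begin
  T (λ k → fromℕ k * a k) (suc n)
    ≡⟨ T-cong (suc n) (λ k → halve (fromℕ k) (a k)) ⟩
  T (λ k → (1 / 2) * ((2 * fromℕ k + 0ℚ) * a k)) (suc n)
    ≡⟨ T-* (suc n) (1 / 2) _ ⟩
  (1 / 2) * T (λ k → (2 * fromℕ k + 0ℚ) * a k) (suc n)
    ≡⟨ cong ((1 / 2) *_) (H-cong (suc n) (λ m → trans (spread-index m 0ℚ a) (lowered m))) ⟩
  (1 / 2) * H (suc n) (lower (spread a ∘ suc))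
    ≡⟨ cong ((1 / 2) *_) (H-lower n (spread a ∘ suc)) ⟩
  (1 / 2) * (fromℕ (suc n) * H n (spread a ∘ suc))
    ≡⟨ cong (λ p → (1 / 2) * (fromℕ (suc n) * p)) (difference (T a n) (H n (spread a ∘ suc))) ⟩
  (1 / 2) * (fromℕ (suc n) * (T a (suc n) - 2 * T a n)) ∎
  where
  open ≡-Reasoning
  halve : ∀ k p → k * p ≡ (1 / 2) * ((2 * k + 0ℚ) * p)
  halve = solve-∀ ℚ-ring
  difference : ∀ p q → q ≡ 2 * p + q - 2 * p
  difference = solve-∀ ℚ-ring
  lowered : ∀ m → (fromℕ m + 0ℚ) * spread a m ≡ lower (spread a ∘ suc) m
  lowered zero    = ℚ.*-zeroˡ (a 0)
  lowered (suc m) = cong (_* spread a (suc m)) (ℚ.+-identityʳ (fromℕ (suc m)))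

-- Nonnegativity and bounds

0≤-+ : ∀ {p q} → 0ℚ ≤ p → 0ℚ ≤ q → 0ℚ ≤ p + q
0≤-+ 0≤p 0≤q = ℚ.+-mono-≤ 0≤p 0≤q

0≤-* : ∀ {p q} → 0ℚ ≤ p → 0ℚ ≤ q → 0ℚ ≤ p * q
0≤-* {p} {q} 0≤p 0≤q = subst (_≤ p * q) (ℚ.*-zeroʳ p) (ℚ.*-monoˡ-≤-nonNeg p {{ℚ.nonNegative 0≤p}} 0≤q)

0<-* : ∀ {p q} → 0ℚ < p → 0ℚ < q → 0ℚ < p * q
0<-* {p} {q} 0<p 0<q = subst (_< p * q) (ℚ.*-zeroʳ p) (ℚ.*-monoʳ-<-pos p {{ℚ.positive 0<p}} 0<q)

0≤-sub : ∀ {p q} → 0ℚ ≤ q - p → p ≤ q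
0≤-sub {p} {q} 0≤q-p = subst₂ _≤_ (ℚ.+-identityˡ p) (cancel q p) (ℚ.+-monoˡ-≤ p 0≤q-p)
  where
  cancel : ∀ q p → q - p + p ≡ q
  cancel = solve-∀ ℚ-ring

*-monoˡ : ∀ {p q r} → 0ℚ ≤ r → p ≤ q → r * p ≤ r * q
*-monoˡ {r = r} 0≤r = ℚ.*-monoˡ-≤-nonNeg r {{ℚ.nonNegative 0≤r}}

*-monoʳ : ∀ {p q r} → 0ℚ ≤ r → p ≤ q → p * r ≤ q * r
*-monoʳ {r = r} 0≤r = ℚ.*-monoʳ-≤-nonNeg r {{ℚ.nonNegative 0≤r}}

∣∣-≤ : ∀ {p q} → p ≤ q → - p ≤ q → ∣ p ∣ ≤ q
∣∣-≤ {p} {q} p≤q -p≤q with ℚ.∣p∣≡p∨∣p∣≡-p p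
... | inj₁ eq = subst (_≤ q) (sym eq) p≤q
... | inj₂ eq = subst (_≤ q) (sym eq) -p≤q

≤∣∣ : ∀ p → p ≤ ∣ p ∣
≤∣∣ p with ℚ.≤-total 0ℚ p
... | inj₁ 0≤p = ℚ.≤-reflexive (sym (ℚ.0≤p⇒∣p∣≡p 0≤p))
... | inj₂ p≤0 = ℚ.≤-trans p≤0 (ℚ.0≤∣p∣ p)

-≤∣∣ : ∀ p → - p ≤ ∣ p ∣
-≤∣∣ p = subst (- p ≤_) (ℚ.∣-p∣≡∣p∣ p) (≤∣∣ (- p))

horner : ∀ {n p} c .{{_ : NonNegative c}} → 0ℚ ≤ n → 0ℚ ≤ p → 0ℚ ≤ c + n * p
horner c 0≤n 0≤p = 0≤-+ (ℚ.nonNegative⁻¹ c) (0≤-* 0≤n 0≤p)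

-- Reduces a bound on e = (K/D) X to the nonnegativity of C D - K and C D + K. In the applications
-- these are polynomials in n, and C is taken large enough for their coefficients to be nonnegative,
-- as `horner` requires.
quotient-bound : ∀ {e D X} C K → 0ℚ < D → D * e ≡ K * X → 0ℚ ≤ X → 0ℚ ≤ C * D - K → 0ℚ ≤ C * D + K → ∣ e ∣ ≤ C * X
quotient-bound {e} {D} {X} C K 0<D De≡KX 0≤X lo hi = ∣∣-≤
  (ℚ.*-cancelˡ-≤-pos D {{ℚ.positive 0<D}} (0≤-sub (subst (0ℚ ≤_)
    (trans (above C D K X) (cong (λ p → D * (C * X) - p) (sym De≡KX))) (0≤-* lo 0≤X))))
  (ℚ.*-cancelˡ-≤-pos D {{ℚ.positive 0<D}} (0≤-sub (subst (0ℚ ≤_)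
    (trans (below C D K X) (trans (cong (D * (C * X) +_) (sym De≡KX)) (neg C D e X))) (0≤-* hi 0≤X))))
  where
  above : ∀ C D K X → (C * D - K) * X ≡ D * (C * X) - K * X
  above = solve-∀ ℚ-ring
  below : ∀ C D K X → (C * D + K) * X ≡ D * (C * X) + K * X
  below = solve-∀ ℚ-ring
  neg : ∀ C D e X → D * (C * X) + D * e ≡ D * (C * X) - D * (- e)
  neg = solve-∀ ℚ-ring

infix 4 _≲_

-- One constant for every n, with no threshold: T a n also involves the entries of `a` at small k,
-- so a bound valid only from some point on could not be carried through `T` directly.
_≲_ : (f g : ℕ → ℚ) → Set
f ≲ g = ∃ λ C → ∀ n → ∣ f n ∣ ≤ C * g n

≲-cong : ∀ {f f′ g} → f ≗ f′ → f ≲ g → f′ ≲ g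
≲-cong f≡f′ (C , f≤) = C , λ n → subst (λ p → ∣ p ∣ ≤ _) (f≡f′ n) (f≤ n)

≲-+ : ∀ {f f′ g} → f ≲ g → f′ ≲ g → (λ n → f n + f′ n) ≲ g
≲-+ {f} {f′} {g} (C , f≤) (C′ , f′≤) = C + C′ , λ n → ℚ.≤-trans (ℚ.∣p+q∣≤∣p∣+∣q∣ (f n) (f′ n))
  (ℚ.≤-trans (ℚ.+-mono-≤ (f≤ n) (f′≤ n)) (ℚ.≤-reflexive (sym (ℚ.*-distribʳ-+ (g n) C C′))))

≲-* : ∀ {f g} c → f ≲ g → (λ n → c * f n) ≲ g
≲-* {f} {g} c (C , f≤) = ∣ c ∣ * C , λ n → ℚ.≤-trans (ℚ.≤-reflexive (ℚ.∣p*q∣≡∣p∣*∣q∣ c (f n)))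
  (ℚ.≤-trans (*-monoˡ (ℚ.0≤∣p∣ c) (f≤ n)) (ℚ.≤-reflexive (sym (ℚ.*-assoc ∣ c ∣ C (g n)))))

≲-trans : ∀ {f g k} → f ≲ g → g ≲ k → f ≲ k
≲-trans {f} {g} {k} (C , f≤) (C′ , g≤) = ∣ C ∣ * C′ , λ n → ℚ.≤-trans (f≤ n)
  (ℚ.≤-trans (ℚ.≤-trans (≤∣∣ (C * g n)) (ℚ.≤-reflexive (ℚ.∣p*q∣≡∣p∣*∣q∣ C (g n))))
  (ℚ.≤-trans (*-monoˡ (ℚ.0≤∣p∣ C) (g≤ n)) (ℚ.≤-reflexive (sym (ℚ.*-assoc ∣ C ∣ C′ (k n))))))

-- The constant is enlarged to cover n = 0. Pruning yields information on sizes n + 1 only, and `T`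
-- needs the bound at every size.
≲-extend : ∀ {f g} → (∀ n → 0ℚ < g n) → (f ∘ suc) ≲ (g ∘ suc) → f ≲ g
≲-extend {f} {g} 0<g (C , f≤) = C ℚ.⊔ C₀ , bound
  where
  instance
    g₀-pos : Positive (g 0)
    g₀-pos = ℚ.positive (0<g 0)
    g₀-nonZero : ℚ.NonZero (g 0)
    g₀-nonZero = ℚ.pos⇒nonZero (g 0)
  C₀ : ℚ
  C₀ = ∣ f 0 ∣ * ℚ.1/ g 0
  bound : ∀ n → ∣ f n ∣ ≤ (C ℚ.⊔ C₀) * g n
  bound zero    = ℚ.≤-trans (ℚ.≤-reflexive (sym (trans (ℚ.*-assoc ∣ f 0 ∣ (ℚ.1/ g 0) (g 0))
    (trans (cong (∣ f 0 ∣ *_) (ℚ.*-inverseˡ (g 0))) (ℚ.*-identityʳ ∣ f 0 ∣)))))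
    (*-monoʳ (ℚ.<⇒≤ (0<g 0)) (ℚ.p≤q⊔p C C₀))
  bound (suc n) = ℚ.≤-trans (f≤ n) (*-monoʳ (ℚ.<⇒≤ (0<g (suc n))) (ℚ.p≤p⊔q C C₀))

H-mono : ∀ n {a b} → (∀ m → a m ≤ b m) → H n a ≤ H n b
H-mono zero    a≤b = a≤b 0
H-mono (suc n) a≤b = ℚ.+-mono-≤ (ℚ.*-monoˡ-≤-nonNeg 2 (H-mono n a≤b)) (H-mono n (a≤b ∘ suc))

spread-mono : ∀ m {a b} → (∀ k → a k ≤ b k) → spread a m ≤ spread b m
spread-mono zero          a≤b = a≤b 0
spread-mono (suc zero)    a≤b = ℚ.≤-refl
spread-mono (suc (suc m)) a≤b = spread-mono m (a≤b ∘ suc)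

T-mono : ∀ n {a b} → (∀ k → a k ≤ b k) → T a n ≤ T b n
T-mono n a≤b = H-mono n λ m → spread-mono m a≤b

T-neg : ∀ n a → T (λ k → - a k) n ≡ - T a n
T-neg n a = trans (T-cong n λ k → neg (a k)) (trans (T-* n (- 1) a) (sym (neg (T a n))))
  where
  neg : ∀ p → - p ≡ - 1 * p
  neg = solve-∀ ℚ-ring

T-sub : ∀ n a b → T (λ k → a k - b k) n ≡ T a n - T b n
T-sub n a b = trans (T-+ n a (λ k → - b k)) (cong (T a n +_) (T-neg n b))

-- The weights of `T` are nonnegative, so it preserves the two inequalities that make up a bound on
-- the absolute value.
≲-T : ∀ {a g} → a ≲ g → T a ≲ T g
≲-T {a} {g} (C , a≤) = C , λ n → ℚ.≤-trans
  (∣∣-≤ (T-mono n λ k → ℚ.≤-trans (≤∣∣ (a k)) (a≤ k))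
    (subst (_≤ T (λ k → C * g k) n) (T-neg n a) (T-mono n λ k → ℚ.≤-trans (-≤∣∣ (a k)) (a≤ k))))
  (ℚ.≤-reflexive (T-* n C g))

0<⁻¹ : ∀ n → 0ℚ < suc n ⁻¹
0<⁻¹ n = subst (0ℚ <_) (sym (ℚ.fromℚᵘ-toℚᵘ (ℚ.1/ fromℕ (suc n)))) (ℚ.positive⁻¹ (ℚ.1/ fromℕ (suc n)))

0<inverseFactorial : ∀ d → 0ℚ < inverseFactorial d
0<inverseFactorial zero    = ℚ.positive⁻¹ 1
0<inverseFactorial (suc d) = 0<-* (0<inverseFactorial d) (0<⁻¹ d)

0<2n+1 : ∀ n → 0ℚ < 2 * fromℕ n + 1
0<2n+1 n = ℚ.+-mono-≤-< (0≤-* {2} (ℚ.nonNegative⁻¹ 2) (0≤fromℕ n)) (ℚ.positive⁻¹ 1)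

0<J : ∀ d k → 0ℚ < J d k
0<J d zero    = 0<inverseFactorial d
0<J d (suc k) = 0<-* {2} (ℚ.positive⁻¹ 2) (0<-* (0<2n+1 k) (0<J (suc d) k))

-- Lets each J d (n+1) be written as a polynomial in n times the member with the largest d in use;
-- relations between them then become polynomial identities.
J-lower : ∀ d n → J d (suc n) ≡ (fromℕ n + (fromℕ d + 2)) * J (suc d) (suc n)
J-lower d n = trans (sym (J-raise d (suc n)))
  (cong (_* J (suc d) (suc n)) (trans (cong (λ p → p + fromℕ d + 1) (fromℕ-suc n)) (assoc (fromℕ n) (fromℕ d))))
  where
  assoc : ∀ n d → n + 1 + d + 1 ≡ n + (d + 2)
  assoc = solve-∀ ℚ-ring

-- T (J d) in terms of J

h₀ : ∀ n → 2 * (2 * fromℕ n + 1) * h 0 n ≡ (fromℕ n + 1) * ((fromℕ n + 2) * J 1 (suc n))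
h₀ n = trans (shape₁ (fromℕ n) (h 0 n)) (trans (sym (h-step 0 n))
  (trans (cong (λ p → (fromℕ n + 2 * 0ℚ + 1) * ((fromℕ n + 2 * 0ℚ + 2) * p)) (h₁≡J₁ n)) (shape₂ (fromℕ n) (J 1 (suc n)))))
  where
  shape₁ : ∀ n p → 2 * (2 * n + 1) * p ≡ 2 * (2 * n + 2 * 0ℚ + 1) * p
  shape₁ = solve-∀ ℚ-ring
  shape₂ : ∀ n p → (n + 2 * 0ℚ + 1) * ((n + 2 * 0ℚ + 2) * p) ≡ (n + 1) * ((n + 2) * p)
  shape₂ = solve-∀ ℚ-ring

-- The constants come from 2 (2 N + 3) = 4 (N + 4) - 10, as division by N + 4 turns J 2 (n+1) into J
-- 3 (n+1).
h₂ : ∀ n → h 2 n ≡ 4 * J 2 (suc n) - 10 * J 3 (suc n)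
h₂ n = cancel-pos (0<-* (0<fromℕ+ n 3) (0<fromℕ+ n 4)) (begin
  (N + 3) * (N + 4) * h 2 n                        ≡⟨ shape (N) (h 2 n) ⟩
  (N + 2 * 1 + 1) * ((N + 2 * 1 + 2) * h 2 n)      ≡⟨ h-step 1 n ⟩
  2 * (2 * N + 2 * 1 + 1) * h 1 n                  ≡⟨ cong (2 * (2 * N + 2 * 1 + 1) *_) (h₁≡J₁ n) ⟩
  2 * (2 * N + 2 * 1 + 1) * J 1 (suc n)            ≡⟨ reduce N (J 3 (suc n)) (J-lower 2 n) (J-lower 1 n) ⟩
  (N + 3) * (N + 4) * (4 * J 2 (suc n) - 10 * J 3 (suc n)) ∎)
  where
  open ≡-Reasoning
  N = fromℕ n
  shape : ∀ n p → (n + 3) * (n + 4) * p ≡ (n + 2 * 1 + 1) * ((n + 2 * 1 + 2) * p)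
  shape = solve-∀ ℚ-ring
  reduce : ∀ N x₃ {x₂ x₁} → x₂ ≡ (N + 4) * x₃ → x₁ ≡ (N + 3) * x₂ →
    2 * (2 * N + 2 * 1 + 1) * x₁ ≡ (N + 3) * (N + 4) * (4 * x₂ - 10 * x₃)
  reduce N x₃ refl refl = identity N x₃
    where
    identity : ∀ N x →
      2 * (2 * N + 2 * 1 + 1) * ((N + 3) * ((N + 4) * x)) ≡ (N + 3) * (N + 4) * (4 * ((N + 4) * x) - 10 * x)
    identity = solve-∀ ℚ-ring

h₃ : ∀ n → (fromℕ n + 6) * ((fromℕ n + 5) * h 3 n) ≡ 4 * (2 * fromℕ n + 5) * (2 * fromℕ n + 3) * J 3 (suc n)
h₃ n = begin
  (N + 6) * ((N + 5) * h 3 n)                           ≡⟨ shape N (h 3 n) ⟩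
  (N + 2 * 2 + 1) * ((N + 2 * 2 + 2) * h 3 n)           ≡⟨ h-step 2 n ⟩
  2 * (2 * N + 2 * 2 + 1) * h 2 n                       ≡⟨ cong (2 * (2 * N + 2 * 2 + 1) *_) (h₂ n) ⟩
  2 * (2 * N + 2 * 2 + 1) * (4 * J 2 (suc n) - 10 * J 3 (suc n))
    ≡⟨ cong (λ p → 2 * (2 * N + 2 * 2 + 1) * (4 * p - 10 * J 3 (suc n))) (J-lower 2 n) ⟩
  2 * (2 * N + 2 * 2 + 1) * (4 * ((N + 4) * J 3 (suc n)) - 10 * J 3 (suc n))
    ≡⟨ identity N (J 3 (suc n)) ⟩
  4 * (2 * N + 5) * (2 * N + 3) * J 3 (suc n) ∎
  where
  open ≡-Reasoning
  N = fromℕ n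
  shape : ∀ n p → (n + 6) * ((n + 5) * p) ≡ (n + 2 * 2 + 1) * ((n + 2 * 2 + 2) * p)
  shape = solve-∀ ℚ-ring
  identity : ∀ N x → 2 * (2 * N + 2 * 2 + 1) * (4 * ((N + 4) * x) - 10 * x) ≡ 4 * (2 * N + 5) * (2 * N + 3) * x
  identity = solve-∀ ℚ-ring

h₃′ : ∀ n → (fromℕ n + 6) * h 3 n ≡ 4 * (2 * fromℕ n + 5) * (2 * fromℕ n + 3) * J 4 (suc n)
h₃′ n = cancel-pos (0<fromℕ+ n 5) (begin
  (N + 5) * ((N + 6) * h 3 n)                                  ≡⟨ swap N (h 3 n) ⟩
  (N + 6) * ((N + 5) * h 3 n)                                  ≡⟨ h₃ n ⟩
  4 * (2 * N + 5) * (2 * N + 3) * J 3 (suc n)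
    ≡⟨ cong (4 * (2 * N + 5) * (2 * N + 3) *_) (J-lower 3 n) ⟩
  4 * (2 * N + 5) * (2 * N + 3) * ((N + 5) * J 4 (suc n))      ≡⟨ move N (J 4 (suc n)) ⟩
  (N + 5) * (4 * (2 * N + 5) * (2 * N + 3) * J 4 (suc n))      ∎)
  where
  open ≡-Reasoning
  N = fromℕ n
  swap : ∀ N p → (N + 5) * ((N + 6) * p) ≡ (N + 6) * ((N + 5) * p)
  swap = solve-∀ ℚ-ring
  move : ∀ N x → 4 * (2 * N + 5) * (2 * N + 3) * ((N + 5) * x) ≡ (N + 5) * (4 * (2 * N + 5) * (2 * N + 3) * x)
  move = solve-∀ ℚ-ring

h₄ : ∀ n → (fromℕ n + 6) * ((fromℕ n + 7) * (fromℕ n + 8)) * h 4 n ≡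
  8 * (2 * fromℕ n + 7) * (2 * fromℕ n + 5) * (2 * fromℕ n + 3) * J 4 (suc n)
h₄ n = begin
  (N + 6) * ((N + 7) * (N + 8)) * h 4 n                     ≡⟨ shape N (h 4 n) ⟩
  (N + 6) * ((N + 2 * 3 + 1) * ((N + 2 * 3 + 2) * h 4 n))   ≡⟨ cong ((N + 6) *_) (h-step 3 n) ⟩
  (N + 6) * (2 * (2 * N + 2 * 3 + 1) * h 3 n)               ≡⟨ move N (h 3 n) ⟩
  2 * (2 * N + 7) * ((N + 6) * h 3 n)                       ≡⟨ cong (2 * (2 * N + 7) *_) (h₃′ n) ⟩
  2 * (2 * N + 7) * (4 * (2 * N + 5) * (2 * N + 3) * J 4 (suc n))   ≡⟨ collect N (J 4 (suc n)) ⟩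
  8 * (2 * N + 7) * (2 * N + 5) * (2 * N + 3) * J 4 (suc n)  ∎
  where
  open ≡-Reasoning
  N = fromℕ n
  shape : ∀ n p → (n + 6) * ((n + 7) * (n + 8)) * p ≡ (n + 6) * ((n + 2 * 3 + 1) * ((n + 2 * 3 + 2) * p))
  shape = solve-∀ ℚ-ring
  move : ∀ N p → (N + 6) * (2 * (2 * N + 2 * 3 + 1) * p) ≡ 2 * (2 * N + 7) * ((N + 6) * p)
  move = solve-∀ ℚ-ring
  collect : ∀ N x → 2 * (2 * N + 7) * (4 * (2 * N + 5) * (2 * N + 3) * x) ≡ 8 * (2 * N + 7) * (2 * N + 5) * (2 * N + 3) * x
  collect = solve-∀ ℚ-ring

-- By `h-ratio` at d = 0, (n+1) h 0 (n+1) equals 2 (2n+1) h 0 n, and half of 2 (2n+1) - 2 (n+1) is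
-- n.
hJ₀ : ∀ n → T (λ k → fromℕ k * J 0 k) (suc n) ≡ fromℕ n * h 0 n
hJ₀ n = begin
  T (λ k → fromℕ k * J 0 k) (suc n)                        ≡⟨ T-index n (J 0) ⟩
  (1 / 2) * (fromℕ (suc n) * (h 0 (suc n) - 2 * h 0 n))
    ≡⟨ cong (λ p → (1 / 2) * (p * (h 0 (suc n) - 2 * h 0 n))) (fromℕ-suc n) ⟩
  (1 / 2) * ((N + 1) * (h 0 (suc n) - 2 * h 0 n))           ≡⟨ expand N (h 0 (suc n)) (h 0 n) ⟩
  (1 / 2) * ((N + 2 * 0ℚ + 1) * h 0 (suc n)) - (N + 1) * h 0 n
    ≡⟨ cong (λ p → (1 / 2) * p - (N + 1) * h 0 n) (h-ratio 0 n) ⟩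
  (1 / 2) * (2 * (2 * N + 2 * 0ℚ + 1) * h 0 n) - (N + 1) * h 0 n  ≡⟨ collect N (h 0 n) ⟩
  N * h 0 n                                                 ∎
  where
  open ≡-Reasoning
  N = fromℕ n
  expand : ∀ N p q → (1 / 2) * ((N + 1) * (p - 2 * q)) ≡ (1 / 2) * ((N + 2 * 0ℚ + 1) * p) - (N + 1) * q
  expand = solve-∀ ℚ-ring
  collect : ∀ N q → (1 / 2) * (2 * (2 * N + 2 * 0ℚ + 1) * q) - (N + 1) * q ≡ N * q
  collect = solve-∀ ℚ-ring

hJ₀′ : ∀ n → 4 * ((2 * fromℕ n + 1) * (2 * fromℕ n + 3)) * T (λ k → fromℕ k * J 0 k) (suc n) ≡
  fromℕ n * (fromℕ n + 1) * (fromℕ n + 2) * ((fromℕ n + 3) * J 1 (2 ℕ.+ n))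
hJ₀′ n = begin
  4 * ((2 * N + 1) * (2 * N + 3)) * T (λ k → fromℕ k * J 0 k) (suc n)
    ≡⟨ cong (4 * ((2 * N + 1) * (2 * N + 3)) *_) (hJ₀ n) ⟩
  4 * ((2 * N + 1) * (2 * N + 3)) * (N * h 0 n)                  ≡⟨ move₁ N (h 0 n) ⟩
  2 * N * (2 * (N + 1) + 1) * (2 * (2 * N + 2 * 0ℚ + 1) * h 0 n)
    ≡⟨ cong (2 * N * (2 * (N + 1) + 1) *_) (h-ratio 0 n) ⟨
  2 * N * (2 * (N + 1) + 1) * ((N + 2 * 0ℚ + 1) * h 0 (suc n))
    ≡⟨ cong (λ p → 2 * N * (2 * p + 1) * ((N + 2 * 0ℚ + 1) * h 0 (suc n))) (fromℕ-suc n) ⟨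
  2 * N * (2 * N′ + 1) * ((N + 2 * 0ℚ + 1) * h 0 (suc n))         ≡⟨ move₂ N N′ (h 0 (suc n)) ⟩
  N * (N + 1) * (2 * (2 * N′ + 1) * h 0 (suc n))                 ≡⟨ cong (N * (N + 1) *_) (h₀ (suc n)) ⟩
  N * (N + 1) * ((N′ + 1) * ((N′ + 2) * J 1 (2 ℕ.+ n)))
    ≡⟨ cong (λ p → N * (N + 1) * ((p + 1) * ((p + 2) * J 1 (2 ℕ.+ n)))) (fromℕ-suc n) ⟩
  N * (N + 1) * ((N + 1 + 1) * ((N + 1 + 2) * J 1 (2 ℕ.+ n)))    ≡⟨ move₃ N (J 1 (2 ℕ.+ n)) ⟩
  N * (N + 1) * (N + 2) * ((N + 3) * J 1 (2 ℕ.+ n))              ∎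
  where
  open ≡-Reasoning
  N  = fromℕ n
  N′ = fromℕ (suc n)
  move₁ : ∀ N p → 4 * ((2 * N + 1) * (2 * N + 3)) * (N * p) ≡ 2 * N * (2 * (N + 1) + 1) * (2 * (2 * N + 2 * 0ℚ + 1) * p)
  move₁ = solve-∀ ℚ-ring
  move₂ : ∀ N N′ p → 2 * N * (2 * N′ + 1) * ((N + 2 * 0ℚ + 1) * p) ≡ N * (N + 1) * (2 * (2 * N′ + 1) * p)
  move₂ = solve-∀ ℚ-ring
  move₃ : ∀ N p → N * (N + 1) * ((N + 1 + 1) * ((N + 1 + 2) * p)) ≡ N * (N + 1) * (N + 2) * ((N + 3) * p)
  move₃ = solve-∀ ℚ-ring

-- Errors of re-expanding the images under T

nonNeg-≡ : ∀ {p q} → p ≡ q → 0ℚ ≤ q → 0ℚ ≤ p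
nonNeg-≡ refl 0≤q = 0≤q

0≤J : ∀ d n → 0ℚ ≤ J d n
0≤J d n = ℚ.<⇒≤ (0<J d n)

-- The constants are those of the inverse factorial series of (N+1) / (4N+2) in 1/(N+2),
-- 1/((N+2)(N+3)), and so on: after 1/4 and 1/8 they are multiplied in turn by 3/2 and 5/2. The next
-- factor 7/2 gives the remainder.
h₀-mean : (λ n → h 0 n - ((1 / 4) * J 0 (suc n) + (1 / 8) * J 1 (suc n) + (3 / 16) * J 2 (suc n) + (15 / 32) * J 3 (suc n)))
  ≲ (J 4 ∘ suc)
h₀-mean = 20 , λ n → quotient-bound 20 ((105 / 16) * (fromℕ n + 5)) (0<-* {2} (ℚ.positive⁻¹ 2) (0<2n+1 n))
  (reduce (fromℕ n) (h 0 n) (J 4 (suc n)) (J-lower 3 n) (J-lower 2 n) (J-lower 1 n) (J-lower 0 n) (h₀ n))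
  (0≤J 4 (suc n))
  (nonNeg-≡ (lo (fromℕ n)) (horner (115 / 16) (0≤fromℕ n) (ℚ.nonNegative⁻¹ (1175 / 16))))
  (nonNeg-≡ (hi (fromℕ n)) (horner (1165 / 16) (0≤fromℕ n) (ℚ.nonNegative⁻¹ (1385 / 16))))
  where
  lo : ∀ N → 20 * (2 * (2 * N + 1)) - (105 / 16) * (N + 5) ≡ 115 / 16 + N * (1175 / 16)
  lo = solve-∀ ℚ-ring
  hi : ∀ N → 20 * (2 * (2 * N + 1)) + (105 / 16) * (N + 5) ≡ 1165 / 16 + N * (1385 / 16)
  hi = solve-∀ ℚ-ring
  distribute : ∀ D p q → D * (p - q) ≡ D * p - D * q
  distribute = solve-∀ ℚ-ring
  reduce : ∀ N y x₄ {x₃ x₂ x₁ x₀} → x₃ ≡ (N + 5) * x₄ → x₂ ≡ (N + 4) * x₃ → x₁ ≡ (N + 3) * x₂ → x₀ ≡ (N + 2) * x₁ →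
    2 * (2 * N + 1) * y ≡ (N + 1) * ((N + 2) * x₁) →
    2 * (2 * N + 1) * (y - ((1 / 4) * x₀ + (1 / 8) * x₁ + (3 / 16) * x₂ + (15 / 32) * x₃)) ≡ (105 / 16) * (N + 5) * x₄
  reduce N y x₄ refl refl refl refl eq = trans (distribute (2 * (2 * N + 1)) y _)
    (trans (cong (λ p → p - 2 * (2 * N + 1) * _) eq) (identity N x₄))
    where
    identity : ∀ N x → (N + 1) * ((N + 2) * ((N + 3) * ((N + 4) * ((N + 5) * x)))) - 2 * (2 * N + 1) *
      ((1 / 4) * ((N + 2) * ((N + 3) * ((N + 4) * ((N + 5) * x)))) + (1 / 8) * ((N + 3) * ((N + 4) * ((N + 5) * x)))
        + (3 / 16) * ((N + 4) * ((N + 5) * x)) + (15 / 32) * ((N + 5) * x))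
      ≡ (105 / 16) * (N + 5) * x
    identity = solve-∀ ℚ-ring

-- By `h₃`, 16 is the limit of the ratio of h 3 n to J 3 (n+1).
h₃-mean : (λ n → h 3 n - 16 * J 3 (suc n)) ≲ (J 4 ∘ suc)
h₃-mean = 112 , λ n → quotient-bound 112 (- 420 + fromℕ n * - 112) (0<fromℕ+ n 6)
  (reduce (fromℕ n) (h 3 n) (J 4 (suc n)) (J-lower 3 n) (h₃′ n))
  (0≤J 4 (suc n))
  (nonNeg-≡ (lo (fromℕ n)) (horner 1092 (0≤fromℕ n) (ℚ.nonNegative⁻¹ 224)))
  (nonNeg-≡ (hi (fromℕ n)) (ℚ.nonNegative⁻¹ 252))
  where
  lo : ∀ N → 112 * (N + 6) - (- 420 + N * - 112) ≡ 1092 + N * 224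
  lo = solve-∀ ℚ-ring
  hi : ∀ N → 112 * (N + 6) + (- 420 + N * - 112) ≡ 252
  hi = solve-∀ ℚ-ring
  distribute : ∀ N y x → (N + 6) * (y - 16 * x) ≡ (N + 6) * y - (N + 6) * (16 * x)
  distribute = solve-∀ ℚ-ring
  reduce : ∀ N y x₄ {x₃} → x₃ ≡ (N + 5) * x₄ → (N + 6) * y ≡ 4 * (2 * N + 5) * (2 * N + 3) * x₄ →
    (N + 6) * (y - 16 * x₃) ≡ (- 420 + N * - 112) * x₄
  reduce N y x₄ refl eq = trans (distribute N y ((N + 5) * x₄))
    (trans (cong (λ p → p - (N + 6) * (16 * ((N + 5) * x₄))) eq) (identity N x₄))
    where
    identity : ∀ N x → 4 * (2 * N + 5) * (2 * N + 3) * x - (N + 6) * (16 * ((N + 5) * x)) ≡ (- 420 + N * - 112) * x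
    identity = solve-∀ ℚ-ring

-- Keeps an error of order J 4 within its class when `T` is applied; 64 is the limit of the ratio of
-- both sides.
h₄-bound : h 4 ≲ (J 4 ∘ suc)
h₄-bound = 64 , λ n → quotient-bound 64 (8 * (2 * fromℕ n + 7) * (2 * fromℕ n + 5) * (2 * fromℕ n + 3))
  (0<-* (0<fromℕ+ n 6) (0<-* (0<fromℕ+ n 7) (0<fromℕ+ n 8))) (h₄ n) (0≤J 4 (suc n))
  (nonNeg-≡ (lo (fromℕ n)) (horner 20664 (0≤fromℕ n) (horner 8208 (0≤fromℕ n) (ℚ.nonNegative⁻¹ 864))))
  (nonNeg-≡ (hi (fromℕ n)) (horner 22344 (0≤fromℕ n)
    (horner 10480 (0≤fromℕ n) (horner 1824 (0≤fromℕ n) (ℚ.nonNegative⁻¹ 128)))))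
  where
  lo : ∀ N → 64 * ((N + 6) * ((N + 7) * (N + 8))) - 8 * (2 * N + 7) * (2 * N + 5) * (2 * N + 3) ≡
    20664 + N * (8208 + N * 864)
  lo = solve-∀ ℚ-ring
  hi : ∀ N → 64 * ((N + 6) * ((N + 7) * (N + 8))) + 8 * (2 * N + 7) * (2 * N + 5) * (2 * N + 3) ≡
    22344 + N * (10480 + N * (1824 + N * 128))
  hi = solve-∀ ℚ-ring

h₀-square : (λ n → h 0 n - ((1 / 4) * J 0 (suc n) + (1 / 8) * J 1 (suc n) + (3 / 16) * J 2 (suc n))) ≲ (J 3 ∘ suc)
h₀-square = 8 , λ n → quotient-bound 8 (15 / 2 + fromℕ n * (15 / 8)) (0<-* {2} (ℚ.positive⁻¹ 2) (0<2n+1 n))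
  (reduce (fromℕ n) (h 0 n) (J 3 (suc n)) (J-lower 2 n) (J-lower 1 n) (J-lower 0 n) (h₀ n))
  (0≤J 3 (suc n))
  (nonNeg-≡ (lo (fromℕ n)) (horner (17 / 2) (0≤fromℕ n) (ℚ.nonNegative⁻¹ (241 / 8))))
  (nonNeg-≡ (hi (fromℕ n)) (horner (47 / 2) (0≤fromℕ n) (ℚ.nonNegative⁻¹ (271 / 8))))
  where
  lo : ∀ N → 8 * (2 * (2 * N + 1)) - (15 / 2 + N * (15 / 8)) ≡ 17 / 2 + N * (241 / 8)
  lo = solve-∀ ℚ-ring
  hi : ∀ N → 8 * (2 * (2 * N + 1)) + (15 / 2 + N * (15 / 8)) ≡ 47 / 2 + N * (271 / 8)
  hi = solve-∀ ℚ-ring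
  distribute : ∀ D p q → D * (p - q) ≡ D * p - D * q
  distribute = solve-∀ ℚ-ring
  reduce : ∀ N y x₃ {x₂ x₁ x₀} → x₂ ≡ (N + 4) * x₃ → x₁ ≡ (N + 3) * x₂ → x₀ ≡ (N + 2) * x₁ →
    2 * (2 * N + 1) * y ≡ (N + 1) * ((N + 2) * x₁) →
    2 * (2 * N + 1) * (y - ((1 / 4) * x₀ + (1 / 8) * x₁ + (3 / 16) * x₂)) ≡ (15 / 2 + N * (15 / 8)) * x₃
  reduce N y x₃ refl refl refl eq = trans (distribute (2 * (2 * N + 1)) y _)
    (trans (cong (λ p → p - 2 * (2 * N + 1) * _) eq) (identity N x₃))
    where
    identity : ∀ N x → (N + 1) * ((N + 2) * ((N + 3) * ((N + 4) * x))) - 2 * (2 * N + 1) *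
      ((1 / 4) * ((N + 2) * ((N + 3) * ((N + 4) * x))) + (1 / 8) * ((N + 3) * ((N + 4) * x)) + (3 / 16) * ((N + 4) * x))
      ≡ (15 / 2 + N * (15 / 8)) * x
    identity = solve-∀ ℚ-ring

h₂-square : (λ n → h 2 n - 4 * J 2 (suc n)) ≲ (J 3 ∘ suc)
h₂-square = 10 , λ n → quotient-bound {D = 1} 10 (- 10) (ℚ.positive⁻¹ 1)
  (trans (cong (λ p → 1 * (p - 4 * J 2 (suc n))) (h₂ n)) (cancel (J 2 (suc n)) (J 3 (suc n))))
  (0≤J 3 (suc n)) (ℚ.nonNegative⁻¹ 20) (ℚ.nonNegative⁻¹ 0)
  where
  cancel : ∀ p q → 1 * (4 * p - 10 * q - 4 * p) ≡ - 10 * q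
  cancel = solve-∀ ℚ-ring

h₃-bound : h 3 ≲ (J 3 ∘ suc)
h₃-bound = 16 , λ n → quotient-bound 16 (4 * (2 * fromℕ n + 5) * (2 * fromℕ n + 3)) (0<-* (0<fromℕ+ n 6) (0<fromℕ+ n 5))
  (trans (ℚ.*-assoc (fromℕ n + 6) (fromℕ n + 5) (h 3 n)) (h₃ n)) (0≤J 3 (suc n))
  (nonNeg-≡ (lo (fromℕ n)) (horner 420 (0≤fromℕ n) (ℚ.nonNegative⁻¹ 112)))
  (nonNeg-≡ (hi (fromℕ n)) (horner 540 (0≤fromℕ n) (horner 240 (0≤fromℕ n) (ℚ.nonNegative⁻¹ 32))))
  where
  lo : ∀ N → 16 * ((N + 6) * (N + 5)) - 4 * (2 * N + 5) * (2 * N + 3) ≡ 420 + N * 112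
  lo = solve-∀ ℚ-ring
  hi : ∀ N → 16 * ((N + 6) * (N + 5)) + 4 * (2 * N + 5) * (2 * N + 3) ≡ 540 + N * (240 + N * 32)
  hi = solve-∀ ℚ-ring

-- The member d = -1 of the family: (2k)! / (k! (k-1)!) for k > 0. Its growth matches the second
-- moment, of order n^2 times the Catalan number.
kJ₀ : ℕ → ℚ
kJ₀ k = fromℕ k * J 0 k

-- By `hJ₀′` the image is the rational multiple N (N+1) / (4 (2N+1) (2N+3)) of kJ₀ (n+2), expanded
-- again in inverse factorials. That formula starts at T kJ₀ 1, hence the use of `≲-extend`.
kJ₀-square : (λ n → T kJ₀ n
    - ((1 / 16) * kJ₀ (suc n) - (1 / 16) * J 0 (suc n) - (3 / 64) * J 1 (suc n) - (3 / 32) * J 2 (suc n)))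
  ≲ (J 3 ∘ suc)
kJ₀-square = ≲-extend (λ n → 0<J 3 (suc n)) (3 , λ n → quotient-bound 3 (K (fromℕ n))
  (0<-* {4} (ℚ.positive⁻¹ 4) (0<-* (0<2n+1 n) (ℚ.+-mono-≤-< (0≤-* {2} (ℚ.nonNegative⁻¹ 2) (0≤fromℕ n)) (ℚ.positive⁻¹ 3))))
  (reduce (fromℕ n) (T kJ₀ (suc n)) (J 3 (2 ℕ.+ n))
    (lowered 2 n 5 refl) (lowered 1 n 4 refl) (lowered 0 n 3 refl)
    (cong (_* J 0 (2 ℕ.+ n)) (trans (fromℕ-+ 2 n) (ℚ.+-comm 2 (fromℕ n)))) (hJ₀′ n))
  (0≤J 3 (2 ℕ.+ n))
  (nonNeg-≡ (lo (fromℕ n)) (horner (513 / 8) (0≤fromℕ n) (horner (2001 / 16) (0≤fromℕ n) (ℚ.nonNegative⁻¹ (843 / 16)))))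
  (nonNeg-≡ (hi (fromℕ n)) (horner (63 / 8) (0≤fromℕ n) (horner (1071 / 16) (0≤fromℕ n) (ℚ.nonNegative⁻¹ (693 / 16))))))
  where
  K : ℚ → ℚ
  K N = - (225 / 8) + N * (- (465 / 16) + N * - (75 / 16))
  lo : ∀ N → 3 * (4 * ((2 * N + 1) * (2 * N + 3))) - (- (225 / 8) + N * (- (465 / 16) + N * - (75 / 16)))
    ≡ 513 / 8 + N * (2001 / 16 + N * (843 / 16))
  lo = solve-∀ ℚ-ring
  hi : ∀ N → 3 * (4 * ((2 * N + 1) * (2 * N + 3))) + (- (225 / 8) + N * (- (465 / 16) + N * - (75 / 16)))
    ≡ 63 / 8 + N * (1071 / 16 + N * (693 / 16))
  hi = solve-∀ ℚ-ring
  lowered : ∀ d n p → 1 + (fromℕ d + 2) ≡ p → J d (2 ℕ.+ n) ≡ (fromℕ n + p) * J (suc d) (2 ℕ.+ n)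
  lowered d n p refl = trans (J-lower d (suc n)) (cong (_* J (suc d) (2 ℕ.+ n))
    (trans (cong (_+ (fromℕ d + 2)) (fromℕ-suc n)) (ℚ.+-assoc (fromℕ n) 1 (fromℕ d + 2))))
  distribute : ∀ D p q → D * (p - q) ≡ D * p - D * q
  distribute = solve-∀ ℚ-ring
  reduce : ∀ N y x₃ {x₂ x₁ x₀ z} → x₂ ≡ (N + 5) * x₃ → x₁ ≡ (N + 4) * x₂ → x₀ ≡ (N + 3) * x₁ → z ≡ (N + 2) * x₀ →
    4 * ((2 * N + 1) * (2 * N + 3)) * y ≡ N * (N + 1) * (N + 2) * ((N + 3) * x₁) →
    4 * ((2 * N + 1) * (2 * N + 3)) * (y - ((1 / 16) * z - (1 / 16) * x₀ - (3 / 64) * x₁ - (3 / 32) * x₂)) ≡ K N * x₃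
  reduce N y x₃ refl refl refl refl eq = trans (distribute (4 * ((2 * N + 1) * (2 * N + 3))) y _)
    (trans (cong (λ p → p - 4 * ((2 * N + 1) * (2 * N + 3)) * _) eq) (identity N x₃))
    where
    identity : ∀ N x → N * (N + 1) * (N + 2) * ((N + 3) * ((N + 4) * ((N + 5) * x))) - 4 * ((2 * N + 1) * (2 * N + 3)) *
      ((1 / 16) * ((N + 2) * ((N + 3) * ((N + 4) * ((N + 5) * x)))) - (1 / 16) * ((N + 3) * ((N + 4) * ((N + 5) * x)))
        - (3 / 64) * ((N + 4) * ((N + 5) * x)) - (3 / 32) * ((N + 5) * x))
      ≡ (- (225 / 8) + N * (- (465 / 16) + N * - (75 / 16))) * x
    identity = solve-∀ ℚ-ring

-- First and second moments for every r

S : (ℕ → ℚ) → ℕ → ℕ → ℚ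
S F r n = 𝒮 n (λ t → F (#branches r t))

S-zero : ∀ F n → S F 0 n ≡ F (suc n) * J 1 n
S-zero F n = begin
  𝒮 n (λ t → F (#branches 0 t))
    ≡⟨ 𝒮-cong n (λ { t refl → trans (cong F (branchCount-zero t)) (sym (ℚ.*-identityʳ (F (suc (#nodes t))))) }) ⟩
  𝒮 n (λ _ → F (suc n) * 1)         ≡⟨ Σ-* (trees n) (F (suc n)) (λ _ → 1) ⟩
  F (suc n) * 𝒮 n (λ _ → 1)         ≡⟨ cong (F (suc n) *_) (𝒮-1 n) ⟩
  F (suc n) * J 1 n                 ∎
  where open ≡-Reasoning

S-suc : ∀ F r n → S F (suc r) (suc n) ≡ T (S F r) n
S-suc F r n = trans (𝒮-cong (suc n) pruned) (𝒮-prune n (λ t → F (#branches r t)))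
  where
  pruned : ∀ t → #nodes t ≡ suc n → F (#branches (suc r) t) ≡ F (#branches r (prune t))
  pruned (node t₁ _ t₂) _ = cong F (branchCount-prune r t₁ t₂)

record Coefficients : Set where
  constructor coefficients
  field
    c₀ c₁ c₂ c₃ : ℚ

combination : Coefficients → (x₀ x₁ x₂ x₃ : ℚ) → ℚ
combination (coefficients c₀ c₁ c₂ c₃) x₀ x₁ x₂ x₃ = c₀ * x₀ + c₁ * x₁ + c₂ * x₂ + c₃ * x₃

T-combination : ∀ n c (f₀ f₁ f₂ f₃ : ℕ → ℚ) →
  T (λ k → combination c (f₀ k) (f₁ k) (f₂ k) (f₃ k)) n ≡ combination c (T f₀ n) (T f₁ n) (T f₂ n) (T f₃ n)
T-combination n (coefficients c₀ c₁ c₂ c₃) f₀ f₁ f₂ f₃ =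
  trans (T-+ n _ _) (cong₂ _+_
    (trans (T-+ n _ _) (cong₂ _+_
      (trans (T-+ n _ _) (cong₂ _+_ (T-* n c₀ f₀) (T-* n c₁ f₁)))
      (T-* n c₂ f₂)))
    (T-* n c₃ f₃))

module _ (F f₀ f₁ f₂ f₃ g : ℕ → ℚ) (0<g : ∀ n → 0ℚ < g n) (Tg≲g : T g ≲ (g ∘ suc)) where

  -- The new error is `T` of the old one, still of order g because T g is, plus the error made by
  -- re-expanding the images of the basis.
  expansion-suc : ∀ r c c′ →
    (λ n → S F r n - combination c (f₀ n) (f₁ n) (f₂ n) (f₃ n)) ≲ g →
    (λ n → combination c (T f₀ n) (T f₁ n) (T f₂ n) (T f₃ n)
         - combination c′ (f₀ (suc n)) (f₁ (suc n)) (f₂ (suc n)) (f₃ (suc n))) ≲ (g ∘ suc) →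
    (λ n → S F (suc r) n - combination c′ (f₀ n) (f₁ n) (f₂ n) (f₃ n)) ≲ g
  expansion-suc r c c′ S≲ T≲ = ≲-extend 0<g (≲-cong (λ n → sym (split n)) (≲-+ (≲-trans (≲-T S≲) Tg≲g) T≲))
    where
    regroup : ∀ p q r → p - r ≡ (p - q) + (q - r)
    regroup = solve-∀ ℚ-ring
    approx image target : ℕ → ℚ
    approx k = combination c (f₀ k) (f₁ k) (f₂ k) (f₃ k)
    image n  = combination c (T f₀ n) (T f₁ n) (T f₂ n) (T f₃ n)
    target n = combination c′ (f₀ (suc n)) (f₁ (suc n)) (f₂ (suc n)) (f₃ (suc n))
    split : ∀ n → S F (suc r) (suc n) - target n ≡ T (λ k → S F r k - approx k) n + (image n - target n)
    split n = begin
      S F (suc r) (suc n) - target n                     ≡⟨ cong (λ p → p - target n) (S-suc F r n) ⟩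
      T (S F r) n - target n                             ≡⟨ regroup (T (S F r) n) (image n) (target n) ⟩
      (T (S F r) n - image n) + (image n - target n)
        ≡⟨ cong (λ p → (T (S F r) n - p) + (image n - target n)) (T-combination n c f₀ f₁ f₂ f₃) ⟨
      (T (S F r) n - T approx n) + (image n - target n)  ≡⟨ cong (_+ (image n - target n)) (T-sub n (S F r) approx) ⟨
      T (λ k → S F r k - approx k) n + (image n - target n) ∎
      where open ≡-Reasoning

-- The coefficients below solve the linear recurrences for r → r + 1, in terms of P = 4ʳ and Q = 4⁻ʳ.

meanCoefficients : (P Q : ℚ) → Coefficients
meanCoefficients P Q = coefficients Q ((1 / 6) * (1 - Q)) ((1 / 20) * (P - Q))
  ((5 / 252) * (P * P) + (1 / 24) * P - (31 / 504) * Q)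

meanMain : (P Q x₀ x₁ x₂ x₃ : ℚ) → ℚ
meanMain P Q = combination (meanCoefficients P Q)

-- For r = 0 the expansion is exact: the sum is (n+1) J 1 n = J 0 n, and at P = Q = 1 the other
-- coefficients vanish. In the step only J 0 and J 3 produce errors, the images of J 1 and J 2 being
-- exact combinations.
mean-expansion : ∀ r → (λ n → S fromℕ r n - meanMain (4 ^ r) ((1 / 4) ^ r) (J 0 n) (J 1 n) (J 2 n) (J 3 n)) ≲ J 4
mean-expansion zero = 0ℚ , λ n → ℚ.≤-reflexive (trans (cong ∣_∣ (exact n)) (sym (ℚ.*-zeroˡ (J 4 n))))
  where
  cancel : ∀ x₀ x₁ x₂ x₃ → x₀ - (1 * x₀ + (1 / 6) * (1 - 1) * x₁ + (1 / 20) * (1 - 1) * x₂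
    + ((5 / 252) * (1 * 1) + (1 / 24) * 1 - (31 / 504) * 1) * x₃) ≡ 0ℚ
  cancel = solve-∀ ℚ-ring
  start : ∀ n → S fromℕ 0 n ≡ J 0 n
  start n = trans (S-zero fromℕ n) (trans
    (cong (_* J 1 n) (trans (fromℕ-suc n) (cong (_+ 1) (sym (ℚ.+-identityʳ (fromℕ n))))))
    (J-raise 0 n))
  exact : ∀ n → S fromℕ 0 n - meanMain 1 1 (J 0 n) (J 1 n) (J 2 n) (J 3 n) ≡ 0ℚ
  exact n = trans (cong (λ p → p - meanMain 1 1 (J 0 n) (J 1 n) (J 2 n) (J 3 n)) (start n))
    (cancel (J 0 n) (J 1 n) (J 2 n) (J 3 n))
mean-expansion (suc r) = expansion-suc fromℕ (J 0) (J 1) (J 2) (J 3) (J 4) (0<J 4) h₄-bound r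
  (meanCoefficients P Q) (meanCoefficients (4 * P) ((1 / 4) * Q)) (mean-expansion r)
  (≲-cong (λ n → identity P Q (h 0 n) (h 3 n) (J 0 (suc n)) (J 2 (suc n)) (J 3 (suc n)) (h₁≡J₁ n) (h₂ n))
    (≲-+ (≲-* Q h₀-mean) (≲-* ((5 / 252) * (P * P) + (1 / 24) * P - (31 / 504) * Q) h₃-mean)))
  where
  P = 4 ^ r
  Q = (1 / 4) ^ r
  identity : ∀ P Q y₀ y₃ x₀ x₂ x₃ {x₁ y₁ y₂} → y₁ ≡ x₁ → y₂ ≡ 4 * x₂ - 10 * x₃ →
    Q * (y₀ - ((1 / 4) * x₀ + (1 / 8) * x₁ + (3 / 16) * x₂ + (15 / 32) * x₃))
      + ((5 / 252) * (P * P) + (1 / 24) * P - (31 / 504) * Q) * (y₃ - 16 * x₃)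
    ≡ meanMain P Q y₀ y₁ y₂ y₃ - meanMain (4 * P) ((1 / 4) * Q) x₀ x₁ x₂ x₃
  identity P Q y₀ y₃ x₀ x₂ x₃ {x₁} refl refl = ring P Q y₀ y₃ x₀ x₁ x₂ x₃
    where
    ring : ∀ P Q y₀ y₃ x₀ x₁ x₂ x₃ →
      Q * (y₀ - ((1 / 4) * x₀ + (1 / 8) * x₁ + (3 / 16) * x₂ + (15 / 32) * x₃))
        + ((5 / 252) * (P * P) + (1 / 24) * P - (31 / 504) * Q) * (y₃ - 16 * x₃)
      ≡ (Q * y₀ + (1 / 6) * (1 - Q) * x₁ + (1 / 20) * (P - Q) * (4 * x₂ - 10 * x₃)
          + ((5 / 252) * (P * P) + (1 / 24) * P - (31 / 504) * Q) * y₃)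
        - ((1 / 4) * Q * x₀ + (1 / 6) * (1 - (1 / 4) * Q) * x₁ + (1 / 20) * (4 * P - (1 / 4) * Q) * x₂
          + ((5 / 252) * (4 * P * (4 * P)) + (1 / 24) * (4 * P) - (31 / 504) * ((1 / 4) * Q)) * x₃)
    ring = solve-∀ ℚ-ring

square : ℕ → ℚ
square b = fromℕ b * fromℕ b

squareCoefficients : (P Q : ℚ) → Coefficients
squareCoefficients P Q = coefficients (Q * Q) ((1 / 3) * (Q * Q) + (2 / 3) * Q)
  ((1 / 180) * (Q * Q) - (1 / 9) * Q + 19 / 180) ((1 / 126) * (Q * Q) - (1 / 30) * Q + (8 / 315) * P)

squareMain : (P Q z x₀ x₁ x₂ : ℚ) → ℚ
squareMain P Q = combination (squareCoefficients P Q)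

-- For r = 0 it is exact, as (n+1)^2 J 1 n = n J 0 n + J 0 n. In the step all basis sequences but J
-- 1 contribute an error, and the term -10 J 3 of `h₂` is now part of it.
square-expansion : ∀ r → (λ n → S square r n - squareMain (4 ^ r) ((1 / 4) ^ r) (kJ₀ n) (J 0 n) (J 1 n) (J 2 n)) ≲ J 3
square-expansion zero = 0ℚ , λ n → ℚ.≤-reflexive (trans (cong ∣_∣ (exact n)) (sym (ℚ.*-zeroˡ (J 3 n))))
  where
  cancel : ∀ N x₁ x₂ → (N + 1) * (N + 1) * x₁ - (1 * 1 * (N * ((N + 0ℚ + 1) * x₁))
    + ((1 / 3) * (1 * 1) + (2 / 3) * 1) * ((N + 0ℚ + 1) * x₁)
    + ((1 / 180) * (1 * 1) - (1 / 9) * 1 + 19 / 180) * x₁ + ((1 / 126) * (1 * 1) - (1 / 30) * 1 + (8 / 315) * 1) * x₂) ≡ 0ℚ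
  cancel = solve-∀ ℚ-ring
  exact : ∀ n → S square 0 n - squareMain 1 1 (kJ₀ n) (J 0 n) (J 1 n) (J 2 n) ≡ 0ℚ
  exact n = trans
    (cong₂ (λ p q → p - squareMain 1 1 (fromℕ n * q) q (J 1 n) (J 2 n))
      (trans (S-zero square n) (cong (λ p → p * p * J 1 n) (fromℕ-suc n))) (sym (J-raise 0 n)))
    (cancel (fromℕ n) (J 1 n) (J 2 n))
square-expansion (suc r) = expansion-suc square kJ₀ (J 0) (J 1) (J 2) (J 3) (0<J 3) h₃-bound r
  (squareCoefficients P Q) (squareCoefficients (4 * P) ((1 / 4) * Q)) (square-expansion r)
  (≲-cong (λ n → identity P Q (T kJ₀ n) (h 0 n) (h 2 n) (kJ₀ (suc n)) (J 0 (suc n)) (J 2 (suc n)) (h₁≡J₁ n))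
    (≲-+ (≲-+ (≲-* (Q * Q) kJ₀-square) (≲-* ((1 / 3) * (Q * Q) + (2 / 3) * Q) h₀-square))
      (≲-* ((1 / 126) * (Q * Q) - (1 / 30) * Q + (8 / 315) * P) h₂-square)))
  where
  P = 4 ^ r
  Q = (1 / 4) ^ r
  identity : ∀ P Q w y₀ y₂ z x₀ x₂ {x₁ y₁} → y₁ ≡ x₁ →
    Q * Q * (w - ((1 / 16) * z - (1 / 16) * x₀ - (3 / 64) * x₁ - (3 / 32) * x₂))
      + ((1 / 3) * (Q * Q) + (2 / 3) * Q) * (y₀ - ((1 / 4) * x₀ + (1 / 8) * x₁ + (3 / 16) * x₂))
      + ((1 / 126) * (Q * Q) - (1 / 30) * Q + (8 / 315) * P) * (y₂ - 4 * x₂)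
    ≡ squareMain P Q w y₀ y₁ y₂ - squareMain (4 * P) ((1 / 4) * Q) z x₀ x₁ x₂
  identity P Q w y₀ y₂ z x₀ x₂ {x₁} refl = ring P Q w y₀ y₂ z x₀ x₁ x₂
    where
    ring : ∀ P Q w y₀ y₂ z x₀ x₁ x₂ →
      Q * Q * (w - ((1 / 16) * z - (1 / 16) * x₀ - (3 / 64) * x₁ - (3 / 32) * x₂))
        + ((1 / 3) * (Q * Q) + (2 / 3) * Q) * (y₀ - ((1 / 4) * x₀ + (1 / 8) * x₁ + (3 / 16) * x₂))
        + ((1 / 126) * (Q * Q) - (1 / 30) * Q + (8 / 315) * P) * (y₂ - 4 * x₂)
      ≡ (Q * Q * w + ((1 / 3) * (Q * Q) + (2 / 3) * Q) * y₀
          + ((1 / 180) * (Q * Q) - (1 / 9) * Q + 19 / 180) * x₁ + ((1 / 126) * (Q * Q) - (1 / 30) * Q + (8 / 315) * P) * y₂)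
        - ((1 / 4) * Q * ((1 / 4) * Q) * z + ((1 / 3) * ((1 / 4) * Q * ((1 / 4) * Q)) + (2 / 3) * ((1 / 4) * Q)) * x₀
          + ((1 / 180) * ((1 / 4) * Q * ((1 / 4) * Q)) - (1 / 9) * ((1 / 4) * Q) + 19 / 180) * x₁
          + ((1 / 126) * ((1 / 4) * Q * ((1 / 4) * Q)) - (1 / 30) * ((1 / 4) * Q) + (8 / 315) * (4 * P)) * x₂)
    ring = solve-∀ ℚ-ring

-- Products of bounds and the passage to O

≲-mul : ∀ {f f′ g g′} → f ≲ g → f′ ≲ g′ → (λ n → f n * f′ n) ≲ (λ n → g n * g′ n)
≲-mul {f} {f′} {g} {g′} (C , f≤) (C′ , f′≤) = C * C′ , λ n → begin
  ∣ f n * f′ n ∣            ≡⟨ ℚ.∣p*q∣≡∣p∣*∣q∣ (f n) (f′ n) ⟩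
  ∣ f n ∣ * ∣ f′ n ∣        ≤⟨ *-monoʳ (ℚ.0≤∣p∣ (f′ n)) (f≤ n) ⟩
  C * g n * ∣ f′ n ∣        ≤⟨ *-monoˡ (ℚ.≤-trans (ℚ.0≤∣p∣ (f n)) (f≤ n)) (f′≤ n) ⟩
  C * g n * (C′ * g′ n)     ≡⟨ regroup C (g n) C′ (g′ n) ⟩
  C * C′ * (g n * g′ n)     ∎
  where
  open ℚ.≤-Reasoning
  regroup : ∀ a b c d → a * b * (c * d) ≡ a * c * (b * d)
  regroup = solve-∀ ℚ-ring

≲-respʳ : ∀ {f g g′} → g ≗ g′ → f ≲ g → f ≲ g′
≲-respʳ g≡g′ (C , f≤) = C , λ n → subst (λ p → _ ≤ C * p) (g≡g′ n) (f≤ n)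

-- The threshold 1 leaves out n = 0, where `⁻¹` is only a convention.
≲⇒∈O : ∀ {f g} → (∀ n → 0ℚ ≤ g (suc n)) → (f ∘ suc) ≲ (g ∘ suc) → f ∈O g
≲⇒∈O {f} {g} 0≤g (C , f≤) = C , 1 , bound
  where
  bound : ∀ n → 1 ℕ.≤ n → ∣ f n ∣ ≤ C * ∣ g n ∣
  bound (suc n) _ = subst (λ p → ∣ f (suc n) ∣ ≤ C * p) (sym (ℚ.0≤p⇒∣p∣≡p (0≤g n))) (f≤ n)

-- Expectations as quotients by the Catalan number J 1 n

/-inverseˡ : ∀ m .{{_ : ℕ.NonZero m}} → (ℤ.+ 1 / m) * fromℕ m ≡ 1
/-inverseˡ (suc m) = ⁻¹-inverseˡ m

length-trees : ∀ n → fromℕ (length (trees n)) ≡ J 1 n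
length-trees n = trans (sym (Σ-1 (trees n))) (𝒮-1 n)

𝔼-J₁ : ∀ n X → 𝔼 n X * J 1 n ≡ 𝒮 n X
𝔼-J₁ n X = begin
  𝒮 n X * w * J 1 n                          ≡⟨ cong (𝒮 n X * w *_) (length-trees n) ⟨
  𝒮 n X * w * fromℕ (length (trees n))       ≡⟨ ℚ.*-assoc (𝒮 n X) w _ ⟩
  𝒮 n X * (w * fromℕ (length (trees n)))     ≡⟨ cong (𝒮 n X *_) (/-inverseˡ (length (trees n)) {{trees-nonZero n}}) ⟩
  𝒮 n X * 1                                  ≡⟨ ℚ.*-identityʳ (𝒮 n X) ⟩
  𝒮 n X                                      ∎
  where
  open ≡-Reasoning
  w : ℚ
  w = (ℤ.+ 1 / length (trees n)) {{trees-nonZero n}}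

-- Variance plus squared mean is the second moment; multiplied by the number of trees this becomes a
-- plain sum, accessible to pruning.
𝕍-J₁ : ∀ n X → (𝕍 n X + 𝔼 n X * 𝔼 n X) * J 1 n ≡ 𝒮 n (λ t → X t * X t)
𝕍-J₁ n X = begin
  (𝕍 n X + μ * μ) * J 1 n                                             ≡⟨ ℚ.*-distribʳ-+ (J 1 n) (𝕍 n X) (μ * μ) ⟩
  𝕍 n X * J 1 n + μ * μ * J 1 n                                       ≡⟨ cong (_+ μ * μ * J 1 n) (𝔼-J₁ n _) ⟩
  𝒮 n (λ t → (X t - μ) * (X t - μ)) + μ * μ * J 1 n                   ≡⟨ cong (_+ μ * μ * J 1 n) expanded ⟩
  𝒮 n (λ t → X t * X t) + (- 2 * μ * (μ * J 1 n) + μ * μ * J 1 n) + μ * μ * J 1 n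
    ≡⟨ collect (𝒮 n (λ t → X t * X t)) μ (J 1 n) ⟩
  𝒮 n (λ t → X t * X t)                                               ∎
  where
  open ≡-Reasoning
  μ : ℚ
  μ = 𝔼 n X
  expand : ∀ x m → (x - m) * (x - m) ≡ x * x + (- 2 * m * x + m * m * 1)
  expand = solve-∀ ℚ-ring
  collect : ∀ s m x → s + (- 2 * m * (m * x) + m * m * x) + m * m * x ≡ s
  collect = solve-∀ ℚ-ring
  expanded : 𝒮 n (λ t → (X t - μ) * (X t - μ)) ≡ 𝒮 n (λ t → X t * X t) + (- 2 * μ * (μ * J 1 n) + μ * μ * J 1 n)
  expanded = begin
    𝒮 n (λ t → (X t - μ) * (X t - μ))
      ≡⟨ Σ-cong (trees n) (λ t → expand (X t) μ) ⟩
    𝒮 n (λ t → X t * X t + (- 2 * μ * X t + μ * μ * 1))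
      ≡⟨ Σ-+ (trees n) (λ t → X t * X t) (λ t → - 2 * μ * X t + μ * μ * 1) ⟩
    𝒮 n (λ t → X t * X t) + 𝒮 n (λ t → - 2 * μ * X t + μ * μ * 1)
      ≡⟨ cong (𝒮 n (λ t → X t * X t) +_) (Σ-+ (trees n) (λ t → - 2 * μ * X t) (λ _ → μ * μ * 1)) ⟩
    𝒮 n (λ t → X t * X t) + (𝒮 n (λ t → - 2 * μ * X t) + 𝒮 n (λ _ → μ * μ * 1))
      ≡⟨ cong (𝒮 n (λ t → X t * X t) +_) (cong₂ _+_
           (trans (Σ-* (trees n) (- 2 * μ) X) (cong (- 2 * μ *_) (sym (𝔼-J₁ n X))))
           (trans (Σ-* (trees n) (μ * μ) (λ _ → 1)) (cong (μ * μ *_) (𝒮-1 n)))) ⟩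
    𝒮 n (λ t → X t * X t) + (- 2 * μ * (μ * J 1 n) + μ * μ * J 1 n) ∎

-- Expansions in powers of 1/n; sequences are indexed by m with n = m + 1, and recip k m = 1/(n + k).

recip : ℕ → ℕ → ℚ
recip k m = (k ℕ.+ suc m) ⁻¹

u : ℕ → ℚ
u = recip 0

N : ℕ → ℚ
N m = fromℕ (suc m)

u*N : ∀ m → u m * N m ≡ 1
u*N m = ⁻¹-inverseˡ m

0≤recip : ∀ k m → 0ℚ ≤ recip k m
0≤recip zero    m = ℚ.<⇒≤ (0<⁻¹ m)
0≤recip (suc k) m = ℚ.<⇒≤ (0<⁻¹ (k ℕ.+ suc m))

recip-inverse : ∀ k m → recip (suc k) m * (N m + fromℕ (suc k)) ≡ 1
recip-inverse k m = trans
  (cong (recip (suc k) m *_) (trans (ℚ.+-comm (N m) (fromℕ (suc k))) (sym (fromℕ-+ (suc k) (suc m)))))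
  (⁻¹-inverseˡ (k ℕ.+ suc m))

recip-difference : ∀ k m → recip (suc k) m - u m ≡ - fromℕ (suc k) * (u m * recip (suc k) m)
recip-difference k m = begin
  a - u m                                        ≡⟨ cong₂ _-_ (ℚ.*-identityʳ a) (ℚ.*-identityʳ (u m)) ⟨
  a * 1 - u m * 1                                ≡⟨ cong₂ (λ p q → a * p - u m * q) (u*N m) (recip-inverse k m) ⟨
  a * (u m * N m) - u m * (a * (N m + fromℕ (suc k)))   ≡⟨ collect a (u m) (N m) (fromℕ (suc k)) ⟩
  - fromℕ (suc k) * (u m * a)                    ∎
  where
  open ≡-Reasoning
  a : ℚ
  a = recip (suc k) m
  collect : ∀ a u N k → a * (u * N) - u * (a * (N + k)) ≡ - k * (u * a)
  collect = solve-∀ ℚ-ring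

≲-refl : ∀ {f} → (∀ n → 0ℚ ≤ f n) → f ≲ f
≲-refl {f} 0≤f = 1 , λ n → ℚ.≤-reflexive (trans (ℚ.0≤p⇒∣p∣≡p (0≤f n)) (sym (ℚ.*-identityˡ (f n))))

u≲u : u ≲ u
u≲u = ≲-refl (0≤recip 0)

recip≲u : ∀ k → recip (suc k) ≲ u
recip≲u k = 1 , λ m → ℚ.≤-trans (ℚ.≤-reflexive (ℚ.0≤p⇒∣p∣≡p (0≤recip (suc k) m)))
  (ℚ.≤-trans (0≤-sub (subst (0ℚ ≤_) (sym (trans (flip (u m) (recip (suc k) m)) (trans (cong -_ (recip-difference k m))
      (neg (fromℕ (suc k)) (u m * recip (suc k) m)))))
    (0≤-* (0≤fromℕ (suc k)) (0≤-* (0≤recip 0 m) (0≤recip (suc k) m)))))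
  (ℚ.≤-reflexive (sym (ℚ.*-identityˡ (u m)))))
  where
  flip : ∀ p q → p - q ≡ - (q - p)
  flip = solve-∀ ℚ-ring
  neg : ∀ p q → - (- p * q) ≡ p * q
  neg = solve-∀ ℚ-ring

recip-u≲u² : ∀ k → (λ m → recip (suc k) m - u m) ≲ (λ m → u m * u m)
recip-u≲u² k = ≲-cong (λ m → sym (recip-difference k m)) (≲-* (- fromℕ (suc k)) (≲-mul u≲u (recip≲u k)))

-- At n = m + 1, `p`, `q` and `s` are the quotients of J 2, J 3 and J 4 by J 1.
p q s u² u³ : ℕ → ℚ
p m = recip 2 m
q m = recip 3 m * p m
s m = recip 4 m * q m
u² m = u m * u m
u³ m = u m * u² m

-- Two uses of `recip-difference`: it gives p - u = -2 u p exactly, and then bounds the error of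
-- replacing p by u on the right.
p-expansion : (λ m → p m - (u m - 2 * u² m)) ≲ u³
p-expansion = ≲-cong equation (≲-* (- 2) (≲-mul u≲u (recip-u≲u² 1)))
  where
  regroup : ∀ a b → - 2 * (b * a) + 2 * (b * b) ≡ - 2 * (b * (a - b))
  regroup = solve-∀ ℚ-ring
  regroup′ : ∀ a b → (a - b) + 2 * (b * b) ≡ a - (b - 2 * (b * b))
  regroup′ = solve-∀ ℚ-ring
  equation : ∀ m → - 2 * (u m * (p m - u m)) ≡ p m - (u m - 2 * u² m)
  equation m = trans (sym (regroup (p m) (u m)))
    (trans (cong (_+ 2 * u² m) (sym (recip-difference 1 m))) (regroup′ (p m) (u m)))

q≲u² : q ≲ u²
q≲u² = ≲-mul (recip≲u 2) (recip≲u 1)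

q-expansion : (λ m → q m - u² m) ≲ u³
q-expansion = ≲-cong (λ m → regroup (recip 3 m) (p m) (u m))
  (≲-+ (≲-mul (recip≲u 2) (recip-u≲u² 1)) (≲-mul u≲u (recip-u≲u² 2)))
  where
  regroup : ∀ a b c → a * (b - c) + c * (a - c) ≡ a * b - c * c
  regroup = solve-∀ ℚ-ring

s≲u³ : s ≲ u³
s≲u³ = ≲-mul (recip≲u 3) q≲u²

J-quotient : ∀ d m → J (suc d) (suc m) ≡ recip (suc d) m * J d (suc m)
J-quotient d m = begin
  x                                                  ≡⟨ ℚ.*-identityˡ x ⟨
  1 * x                                              ≡⟨ cong (_* x) (recip-inverse d m) ⟨
  recip (suc d) m * (N m + fromℕ (suc d)) * x        ≡⟨ cong (λ p → recip (suc d) m * (N m + p) * x) (fromℕ-suc d) ⟩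
  recip (suc d) m * (N m + (fromℕ d + 1)) * x        ≡⟨ regroup (recip (suc d) m) (N m) (fromℕ d) x ⟩
  recip (suc d) m * ((N m + fromℕ d + 1) * x)        ≡⟨ cong (recip (suc d) m *_) (J-raise d (suc m)) ⟩
  recip (suc d) m * J d (suc m)                      ∎
  where
  open ≡-Reasoning
  x : ℚ
  x = J (suc d) (suc m)
  regroup : ∀ a N d x → a * (N + (d + 1)) * x ≡ a * ((N + d + 1) * x)
  regroup = solve-∀ ℚ-ring

J₀-quotient : ∀ m → J 0 (suc m) ≡ (N m + 1) * J 1 (suc m)
J₀-quotient m = trans (sym (J-raise 0 (suc m))) (cong (λ p → (p + 1) * J 1 (suc m)) (ℚ.+-identityʳ (N m)))

J₂-quotient : ∀ m → J 2 (suc m) ≡ p m * J 1 (suc m)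
J₂-quotient = J-quotient 1

J₃-quotient : ∀ m → J 3 (suc m) ≡ q m * J 1 (suc m)
J₃-quotient m = trans (J-quotient 2 m)
  (trans (cong (recip 3 m *_) (J₂-quotient m)) (sym (ℚ.*-assoc (recip 3 m) (p m) (J 1 (suc m)))))

J₄-quotient : ∀ m → J 4 (suc m) ≡ s m * J 1 (suc m)
J₄-quotient m = trans (J-quotient 3 m)
  (trans (cong (recip 4 m *_) (J₃-quotient m)) (sym (ℚ.*-assoc (recip 4 m) (q m) (J 1 (suc m)))))

≲-divide : ∀ {f g f′ g′} (x : ℕ → ℚ) → (∀ m → 0ℚ < x m) →
  (∀ m → f m ≡ f′ m * x m) → (∀ m → g m ≡ g′ m * x m) → f ≲ g → f′ ≲ g′
≲-divide {f} {g} {f′} {g′} x 0<x f≡ g≡ (C , f≤) = C , λ m →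
  ℚ.*-cancelʳ-≤-pos (x m) {{ℚ.positive (0<x m)}} (begin
    ∣ f′ m ∣ * x m          ≡⟨ cong (∣ f′ m ∣ *_) (ℚ.0≤p⇒∣p∣≡p (ℚ.<⇒≤ (0<x m))) ⟨
    ∣ f′ m ∣ * ∣ x m ∣      ≡⟨ ℚ.∣p*q∣≡∣p∣*∣q∣ (f′ m) (x m) ⟨
    ∣ f′ m * x m ∣          ≡⟨ cong ∣_∣ (f≡ m) ⟨
    ∣ f m ∣                 ≤⟨ f≤ m ⟩
    C * g m                 ≡⟨ cong (C *_) (g≡ m) ⟩
    C * (g′ m * x m)        ≡⟨ ℚ.*-assoc C (g′ m) (x m) ⟨
    C * g′ m * x m          ∎)
  where open ℚ.≤-Reasoning

factor : ∀ c e y₀ y₂ y₃ x {S x₀ x₂ x₃} → e * x ≡ S → x₀ ≡ y₀ * x → x₂ ≡ y₂ * x → x₃ ≡ y₃ * x →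
  S - combination c x₀ x x₂ x₃ ≡ (e - combination c y₀ 1 y₂ y₃) * x
factor (coefficients c₀ c₁ c₂ c₃) e y₀ y₂ y₃ x refl refl refl refl = ring c₀ c₁ c₂ c₃ e y₀ y₂ y₃ x
  where
  ring : ∀ c₀ c₁ c₂ c₃ e y₀ y₂ y₃ x → e * x - (c₀ * (y₀ * x) + c₁ * x + c₂ * (y₂ * x) + c₃ * (y₃ * x))
    ≡ (e - (c₀ * y₀ + c₁ * 1 + c₂ * y₂ + c₃ * y₃)) * x
  ring = solve-∀ ℚ-ring

factor′ : ∀ c e z y₀ y₂ x {S w x₀ x₂} → e * x ≡ S → w ≡ z * x → x₀ ≡ y₀ * x → x₂ ≡ y₂ * x →
  S - combination c w x₀ x x₂ ≡ (e - combination c z y₀ 1 y₂) * x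
factor′ (coefficients c₀ c₁ c₂ c₃) e z y₀ y₂ x refl refl refl refl = ring c₀ c₁ c₂ c₃ e z y₀ y₂ x
  where
  ring : ∀ c₀ c₁ c₂ c₃ e z y₀ y₂ x → e * x - (c₀ * (z * x) + c₁ * (y₀ * x) + c₂ * x + c₃ * (y₂ * x))
    ≡ (e - (c₀ * z + c₁ * y₀ + c₂ * 1 + c₃ * y₂)) * x
  ring = solve-∀ ℚ-ring

quotient-J₄ : ∀ c {S e : ℕ → ℚ} → (∀ m → e m * J 1 (suc m) ≡ S (suc m)) →
  (λ n → S n - combination c (J 0 n) (J 1 n) (J 2 n) (J 3 n)) ≲ J 4 →
  (λ m → e m - combination c (N m + 1) 1 (p m) (q m)) ≲ s
quotient-J₄ c {S} {e} e*J₁≡S (C , bound) = ≲-divide (J 1 ∘ suc) (0<J 1 ∘ suc)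
  (λ m → factor c (e m) (N m + 1) (p m) (q m) (J 1 (suc m)) (e*J₁≡S m) (J₀-quotient m) (J₂-quotient m) (J₃-quotient m))
  J₄-quotient (C , bound ∘ suc)

quotient-J₃ : ∀ c {S e : ℕ → ℚ} → (∀ m → e m * J 1 (suc m) ≡ S (suc m)) →
  (λ n → S n - combination c (kJ₀ n) (J 0 n) (J 1 n) (J 2 n)) ≲ J 3 →
  (λ m → e m - combination c (N m * (N m + 1)) (N m + 1) 1 (p m)) ≲ q
quotient-J₃ c {S} {e} e*J₁≡S (C , bound) = ≲-divide (J 1 ∘ suc) (0<J 1 ∘ suc)
  (λ m → factor′ c (e m) (N m * (N m + 1)) (N m + 1) (p m) (J 1 (suc m)) (e*J₁≡S m)
    (trans (cong (N m *_) (J₀-quotient m)) (sym (ℚ.*-assoc (N m) (N m + 1) (J 1 (suc m))))) (J₀-quotient m) (J₂-quotient m))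
  J₃-quotient (C , bound ∘ suc)

mean-quotient : ∀ r → (λ m → E (suc m) r - combination (meanCoefficients (4 ^ r) ((1 / 4) ^ r)) (N m + 1) 1 (p m) (q m)) ≲ s
mean-quotient r = quotient-J₄ (meanCoefficients (4 ^ r) ((1 / 4) ^ r)) {S fromℕ r} {λ m → E (suc m) r}
  (λ m → 𝔼-J₁ (suc m) (λ t → fromℕ (#branches r t))) (mean-expansion r)

square-quotient : ∀ r → (λ m → V (suc m) r + E (suc m) r * E (suc m) r
  - combination (squareCoefficients (4 ^ r) ((1 / 4) ^ r)) (N m * (N m + 1)) (N m + 1) 1 (p m)) ≲ q
square-quotient r = quotient-J₃ (squareCoefficients (4 ^ r) ((1 / 4) ^ r)) {S square r}
  {λ m → V (suc m) r + E (suc m) r * E (suc m) r}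
  (λ m → 𝕍-J₁ (suc m) (λ t → fromℕ (#branches r t))) (square-expansion r)

one : ℕ → ℚ
one _ = 1

1≤N : ∀ m → 1 ≤ N m
1≤N m = subst (1 ≤_) (sym (fromℕ-+ 1 m)) (subst (_≤ 1 + fromℕ m) (ℚ.+-identityʳ 1) (ℚ.+-monoʳ-≤ 1 (0≤fromℕ m)))

one≲N : one ≲ N
one≲N = 1 , λ m → subst (1 ≤_) (sym (ℚ.*-identityˡ (N m))) (1≤N m)

u≲one : u ≲ one
u≲one = 1 , λ m → ℚ.≤-trans (ℚ.≤-reflexive (trans (ℚ.0≤p⇒∣p∣≡p (0≤recip 0 m)) (sym (ℚ.*-identityʳ (u m)))))
  (ℚ.≤-trans (*-monoˡ (0≤recip 0 m) (1≤N m)) (ℚ.≤-reflexive (u*N m)))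

N≲N : N ≲ N
N≲N = ≲-refl (0≤fromℕ ∘ suc)

u*≲ : ∀ {f g} → f ≲ g → (λ m → u m * f m) ≲ g
u*≲ {g = g} f≲g = ≲-respʳ (λ m → ℚ.*-identityˡ (g m)) (≲-mul u≲one f≲g)

u²≲u² : u² ≲ u²
u²≲u² = ≲-refl λ m → 0≤-* (0≤recip 0 m) (0≤recip 0 m)

u³*N≲u² : (λ m → u³ m * N m) ≲ u²
u³*N≲u² = ≲-cong (λ m → sym (trans (regroup (u m) (N m)) (trans (cong (_* u² m) (u*N m)) (ℚ.*-identityˡ (u² m))))) u²≲u²
  where
  regroup : ∀ u N → u * (u * u) * N ≡ u * N * (u * u)
  regroup = solve-∀ ℚ-ring

-- The polynomials in 1/n of the theorem, with P Q = 1 already used to simplify the second one.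

meanTarget : (P Q N u : ℚ) → ℚ
meanTarget P Q N u = Q * N + (1 / 6) * (1 + 5 * Q) * 1 + (1 / 20) * (P - Q) * u
  + (1 / 12) * ((5 / 21) * (P * P) - (7 / 10) * P + (97 / 210) * Q) * (u * u)

varianceTarget : (P Q N u : ℚ) → ℚ
varianceTarget P Q N u = (1 / 3) * (Q - Q * Q) * N + - (1 / 90) * (2 - 25 * Q + 23 * (Q * Q))
  + - (1 / 420) * (13 * P - 14 + 7 * Q - 6 * (Q * Q)) * u

module _ (P Q : ℚ) (e : ℕ → ℚ)
  (e≲ : (λ m → e m - combination (meanCoefficients P Q) (N m + 1) 1 (p m) (q m)) ≲ s) where

  private
    A δ : ℕ → ℚ
    A m = meanTarget P Q (N m) (u m)
    δ m = e m - A m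

  mean-asymptotics : δ ≲ u³
  mean-asymptotics = ≲-cong (λ m → identity P Q (e m) (N m) (p m) (q m) (u m))
    (≲-+ (≲-+ (≲-trans e≲ s≲u³) (≲-* ((1 / 20) * (P - Q)) p-expansion))
      (≲-* ((5 / 252) * (P * P) + (1 / 24) * P - (31 / 504) * Q) q-expansion))
    where
    -- The coefficient of 1/n^2 in the target is that of `q` minus twice that of `p`, since 1/(n+2)
    -- contributes -2/n^2.
    identity : ∀ P Q e N p q u →
      (e - (Q * (N + 1) + (1 / 6) * (1 - Q) * 1 + (1 / 20) * (P - Q) * p
          + ((5 / 252) * (P * P) + (1 / 24) * P - (31 / 504) * Q) * q))
        + (1 / 20) * (P - Q) * (p - (u - 2 * (u * u)))
        + ((5 / 252) * (P * P) + (1 / 24) * P - (31 / 504) * Q) * (q - u * u)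
      ≡ e - (Q * N + (1 / 6) * (1 + 5 * Q) * 1 + (1 / 20) * (P - Q) * u
          + (1 / 12) * ((5 / 21) * (P * P) - (7 / 10) * P + (97 / 210) * Q) * (u * u))
    identity = solve-∀ ℚ-ring

  module _ (PQ≡1 : P * Q ≡ 1) (v : ℕ → ℚ)
    (v≲ : (λ m → v m + e m * e m - combination (squareCoefficients P Q) (N m * (N m + 1)) (N m + 1) 1 (p m)) ≲ q) where

    private
      β γ κ b c d t₁ t₀ t₋₁ : ℚ
      β = (1 / 6) * (1 + 5 * Q)
      γ = (1 / 20) * (P - Q)
      κ = (1 / 12) * ((5 / 21) * (P * P) - (7 / 10) * P + (97 / 210) * Q)
      b = (1 / 3) * (Q * Q) + (2 / 3) * Q
      c = (1 / 180) * (Q * Q) - (1 / 9) * Q + 19 / 180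
      d = (1 / 126) * (Q * Q) - (1 / 30) * Q + (8 / 315) * P
      t₁ = (1 / 3) * (Q - Q * Q)
      t₀ = - (1 / 90) * (2 - 25 * Q + 23 * (Q * Q))
      t₋₁ = - (1 / 420) * (13 * P - 14 + 7 * Q - 6 * (Q * Q))

      A≲N : A ≲ N
      A≲N = ≲-+ (≲-+ (≲-+ (≲-* Q N≲N) (≲-* β one≲N)) (≲-* γ u≲N)) (≲-* κ (u*≲ u≲N))
        where
        u≲N : u ≲ N
        u≲N = ≲-trans u≲one one≲N

      -- This product is the difference of the squares of `e` and `A`. As `A` is of order n, the
      -- error n^(-3) of the mean turns into n^(-2).
      δ*[2A+δ]≲u² : (λ m → δ m * (2 * A m + δ m)) ≲ u²
      δ*[2A+δ]≲u² = ≲-trans (≲-mul mean-asymptotics (≲-+ (≲-* 2 A≲N) (≲-trans mean-asymptotics u³≲N))) u³*N≲u²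
        where
        u³≲N : u³ ≲ N
        u³≲N = u*≲ (u*≲ (≲-trans u≲one one≲N))

      A₂ : (N p : ℚ) → ℚ
      A₂ N p = Q * Q * (N * (N + 1)) + b * (N + 1) + c * 1 + d * p

      -- The terms of the squared mean that have order n^(-2) or smaller.
      residual : ℕ → ℚ
      residual m = (γ * γ + 2 * β * κ) * u² m + 2 * γ * κ * u³ m + κ * κ * (u m * u³ m)

      residual≲u² : residual ≲ u²
      residual≲u² = ≲-+ (≲-+ (≲-* (γ * γ + 2 * β * κ) u²≲u²) (≲-* (2 * γ * κ) (u*≲ u²≲u²)))
        (≲-* (κ * κ) (u*≲ (u*≲ u²≲u²)))

      multiple-of-1-PQ : ∀ x → (1 - P * Q) * x ≡ 0ℚ
      multiple-of-1-PQ x = trans (cong (λ y → (1 - y) * x) PQ≡1) (ℚ.*-zeroˡ x)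

      -- This and the next two compare the coefficients of n, 1 and 1/n in second moment minus
      -- squared mean with those of the target. The last two need P Q = 1, so their discrepancy is
      -- exhibited as a multiple of 1 - P Q.
      coefficient₁ : Q * Q + b - 2 * Q * β - t₁ ≡ 0ℚ
      coefficient₁ = identity Q
        where
        identity : ∀ Q → Q * Q + ((1 / 3) * (Q * Q) + (2 / 3) * Q) - 2 * Q * ((1 / 6) * (1 + 5 * Q))
          - (1 / 3) * (Q - Q * Q) ≡ 0ℚ
        identity = solve-∀ ℚ-ring

      coefficient₀ : b + c - β * β - 2 * Q * γ * 1 - t₀ ≡ 0ℚ
      coefficient₀ = trans (identity P Q) (multiple-of-1-PQ (1 / 10))
        where
        identity : ∀ P Q → (1 / 3) * (Q * Q) + (2 / 3) * Q + ((1 / 180) * (Q * Q) - (1 / 9) * Q + 19 / 180)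
          - (1 / 6) * (1 + 5 * Q) * ((1 / 6) * (1 + 5 * Q)) - 2 * Q * ((1 / 20) * (P - Q)) * 1
          - - (1 / 90) * (2 - 25 * Q + 23 * (Q * Q)) ≡ (1 - P * Q) * (1 / 10)
        identity = solve-∀ ℚ-ring

      coefficient₋₁ : d - 2 * Q * κ * 1 - 2 * β * γ - t₋₁ ≡ 0ℚ
      coefficient₋₁ = trans (identity P Q) (multiple-of-1-PQ ((5 / 126) * P - 1 / 30))
        where
        identity : ∀ P Q → (1 / 126) * (Q * Q) - (1 / 30) * Q + (8 / 315) * P
          - 2 * Q * ((1 / 12) * ((5 / 21) * (P * P) - (7 / 10) * P + (97 / 210) * Q)) * 1
          - 2 * ((1 / 6) * (1 + 5 * Q)) * ((1 / 20) * (P - Q))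
          - - (1 / 420) * (13 * P - 14 + 7 * Q - 6 * (Q * Q)) ≡ (1 - P * Q) * ((5 / 126) * P - 1 / 30)
        identity = solve-∀ ℚ-ring

      residual-identity : ∀ m → - 1 * residual m ≡ A₂ (N m) (u m) - A m * A m - varianceTarget P Q (N m) (u m)
      residual-identity m = sym (begin
        A₂ (N m) (u m) - A m * A m - varianceTarget P Q (N m) (u m)
          ≡⟨ expand Q β γ κ b c d t₁ t₀ t₋₁ (N m) (u m) ⟩
        collected (u m * N m) ≡⟨ cong collected (u*N m) ⟩
        collected 1
          ≡⟨ cong₂ (λ x y → x * N m + y + (d - 2 * Q * κ * 1 - 2 * β * γ - t₋₁) * u m - residual m) coefficient₁ coefficient₀ ⟩
        0ℚ * N m + 0ℚ + (d - 2 * Q * κ * 1 - 2 * β * γ - t₋₁) * u m - residual m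
                              ≡⟨ cong (λ x → 0ℚ * N m + 0ℚ + x * u m - residual m) coefficient₋₁ ⟩
        0ℚ * N m + 0ℚ + 0ℚ * u m - residual m ≡⟨ vanish (N m) (u m) (residual m) ⟩
        - 1 * residual m      ∎)
        where
        open ≡-Reasoning
        -- The argument stands for u N, so that u N = 1 can be substituted once the polynomial
        -- expansion is done.
        collected : ℚ → ℚ
        collected y = (Q * Q + b - 2 * Q * β - t₁) * N m + (b + c - β * β - 2 * Q * γ * y - t₀)
          + (d - 2 * Q * κ * y - 2 * β * γ - t₋₁) * u m - residual m
        vanish : ∀ N u x → 0ℚ * N + 0ℚ + 0ℚ * u - x ≡ - 1 * x
        vanish = solve-∀ ℚ-ring
        expand : ∀ Q β γ κ b c d t₁ t₀ t₋₁ N u →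
          (Q * Q * (N * (N + 1)) + b * (N + 1) + c * 1 + d * u)
            - (Q * N + β * 1 + γ * u + κ * (u * u)) * (Q * N + β * 1 + γ * u + κ * (u * u)) - (t₁ * N + t₀ + t₋₁ * u)
          ≡ (Q * Q + b - 2 * Q * β - t₁) * N + (b + c - β * β - 2 * Q * γ * (u * N) - t₀)
            + (d - 2 * Q * κ * (u * N) - 2 * β * γ - t₋₁) * u
            - ((γ * γ + 2 * β * κ) * (u * u) + 2 * γ * κ * (u * (u * u)) + κ * κ * (u * (u * (u * u))))
        expand = solve-∀ ℚ-ring

    -- Four errors of order n^(-2) are added: that of the second moment, that of replacing 1/(n+2)
    -- by 1/n in it, that of squaring the approximate mean, and the residual.
    variance-asymptotics : (λ m → v m - varianceTarget P Q (N m) (u m)) ≲ u²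
    variance-asymptotics = ≲-cong equation
      (≲-+ (≲-+ (≲-+ (≲-trans v≲ q≲u²) (≲-* d (recip-u≲u² 1))) (≲-* (- 1) δ*[2A+δ]≲u²)) (≲-* (- 1) residual≲u²))
      where
      regroup : ∀ v e A M M′ t →
        (v + e * e - M) + (M - M′) + - 1 * ((e - A) * (2 * A + (e - A))) + (M′ - A * A - t) ≡ v - t
      regroup = solve-∀ ℚ-ring
      linear : ∀ x d p u → d * (p - u) ≡ (x + d * p) - (x + d * u)
      linear = solve-∀ ℚ-ring
      equation : ∀ m → (v m + e m * e m - A₂ (N m) (p m)) + d * (p m - u m)
        + - 1 * (δ m * (2 * A m + δ m)) + - 1 * residual m ≡ v m - varianceTarget P Q (N m) (u m)
      equation m = trans
        (cong₂ (λ x y → (v m + e m * e m - A₂ (N m) (p m)) + x + - 1 * (δ m * (2 * A m + δ m)) + y)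
          (linear (Q * Q * (N m * (N m + 1)) + b * (N m + 1) + c * 1) d (p m) (u m))
          (residual-identity m))
        (regroup (v m) (e m) (A m) (A₂ (N m) (p m)) (A₂ (N m) (u m)) (varianceTarget P Q (N m) (u m)))

-- Powers of 4 and the final form of the expansions

^-distrib-* : ∀ a b r → (a * b) ^ r ≡ a ^ r * b ^ r
^-distrib-* a b zero    = refl
^-distrib-* a b (suc r) = trans (cong (a * b *_) (^-distrib-* a b r)) (interchange a b (a ^ r) (b ^ r))
  where
  interchange : ∀ a b c d → a * b * (c * d) ≡ a * c * (b * d)
  interchange = solve-∀ ℚ-ring

1^ : ∀ r → 1 ^ r ≡ 1
1^ zero    = refl
1^ (suc r) = trans (ℚ.*-identityˡ (1 ^ r)) (1^ r)

16^ : ∀ r → 16 ^ r ≡ 4 ^ r * 4 ^ r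
16^ = ^-distrib-* 4 4

64^ : ∀ r → 64 ^ r ≡ 4 ^ r * 4 ^ r * 4 ^ r
64^ r = trans (^-distrib-* 16 4 r) (cong (_* 4 ^ r) (16^ r))

[1/16]^ : ∀ r → (1 / 16) ^ r ≡ (1 / 4) ^ r * (1 / 4) ^ r
[1/16]^ = ^-distrib-* (1 / 4) (1 / 4)

4^*[1/4]^ : ∀ r → 4 ^ r * (1 / 4) ^ r ≡ 1
4^*[1/4]^ r = trans (sym (^-distrib-* 4 (1 / 4) r)) (1^ r)

0≤u^ : ∀ k m → 0ℚ ≤ u m ^ k
0≤u^ zero    m = ℚ.nonNegative⁻¹ 1
0≤u^ (suc k) m = 0≤-* (0≤recip 0 m) (0≤u^ k m)

theorem1 : (r : ℕ) →
    ((λ n → E n r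
          - ( fromℕ n * (1 / 4) ^ r
            + (1 / 6) * (1 + 5 * (1 / 4) ^ r)
            + (1 / 20) * n ⁻¹ * (4 ^ r - (1 / 4) ^ r)
            + (1 / 12) * (n ⁻¹) ^ 2 * ((5 / 21) * 16 ^ r - (7 / 10) * 4 ^ r + (97 / 210) * (1 / 4) ^ r)))
      ∈O (λ n → (n ⁻¹) ^ 3))
  × ((λ n → V n r
          - ( (1 / 3) * (4 ^ r - 1) * (1 / 16) ^ r * fromℕ n
            - (1 / 90) * (2 * 16 ^ r - 25 * 4 ^ r + 23) * (1 / 16) ^ r
            - (1 / 420) * (13 * 64 ^ r - 14 * 16 ^ r + 7 * 4 ^ r - 6) * (1 / 16) ^ r * n ⁻¹))
      ∈O (λ n → (n ⁻¹) ^ 2))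
theorem1 r =
    ≲⇒∈O {λ n → E n r - expectation n} {λ n → n ⁻¹ ^ 3} (0≤u^ 3) (≲-respʳ (λ m → cube (u m))
      (≲-cong (λ m → cong (λ x → E (suc m) r - x) (expectation-≡ m)) mean≲))
  , ≲⇒∈O {λ n → V n r - variance n} {λ n → n ⁻¹ ^ 2} (0≤u^ 2) (≲-respʳ (λ m → square-≡ (u m))
      (≲-cong (λ m → cong (λ x → V (suc m) r - x) (variance-≡ m))
        (variance-asymptotics P Q (λ m → E (suc m) r) (mean-quotient r) (4^*[1/4]^ r)
          (λ m → V (suc m) r) (square-quotient r))))
  where
  P Q : ℚ
  P = 4 ^ r
  Q = (1 / 4) ^ r
  mean≲ : (λ m → E (suc m) r - meanTarget P Q (N m) (u m)) ≲ u³
  mean≲ = mean-asymptotics P Q (λ m → E (suc m) r) (mean-quotient r)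
  expectation variance : ℕ → ℚ
  expectation n = fromℕ n * (1 / 4) ^ r
    + (1 / 6) * (1 + 5 * (1 / 4) ^ r)
    + (1 / 20) * n ⁻¹ * (4 ^ r - (1 / 4) ^ r)
    + (1 / 12) * (n ⁻¹) ^ 2 * ((5 / 21) * 16 ^ r - (7 / 10) * 4 ^ r + (97 / 210) * (1 / 4) ^ r)
  variance n = (1 / 3) * (4 ^ r - 1) * (1 / 16) ^ r * fromℕ n
    - (1 / 90) * (2 * 16 ^ r - 25 * 4 ^ r + 23) * (1 / 16) ^ r
    - (1 / 420) * (13 * 64 ^ r - 14 * 16 ^ r + 7 * 4 ^ r - 6) * (1 / 16) ^ r * n ⁻¹
  cube : ∀ u → u * (u * u) ≡ u * (u * (u * 1))
  cube = solve-∀ ℚ-ring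
  square-≡ : ∀ u → u * u ≡ u * (u * 1)
  square-≡ = solve-∀ ℚ-ring
  expectation-≡ : ∀ m → meanTarget P Q (N m) (u m) ≡ expectation (suc m)
  expectation-≡ m = trans (reorder P Q (N m) (u m)) (cong (λ x → N m * Q + (1 / 6) * (1 + 5 * Q) + (1 / 20) * u m * (P - Q)
    + (1 / 12) * (u m ^ 2) * ((5 / 21) * x - (7 / 10) * P + (97 / 210) * Q)) (sym (16^ r)))
    where
    reorder : ∀ P Q N u → Q * N + (1 / 6) * (1 + 5 * Q) * 1 + (1 / 20) * (P - Q) * u
        + (1 / 12) * ((5 / 21) * (P * P) - (7 / 10) * P + (97 / 210) * Q) * (u * u)
      ≡ N * Q + (1 / 6) * (1 + 5 * Q) + (1 / 20) * u * (P - Q)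
        + (1 / 12) * (u * (u * 1)) * ((5 / 21) * (P * P) - (7 / 10) * P + (97 / 210) * Q)
    reorder = solve-∀ ℚ-ring
  variance-≡ : ∀ m → varianceTarget P Q (N m) (u m) ≡ variance (suc m)
  variance-≡ m = sym (begin
    variance (suc m)
      ≡⟨ cong₂ (λ x y → (1 / 3) * (P - 1) * y * N m - (1 / 90) * (2 * x - 25 * P + 23) * y
           - (1 / 420) * (13 * 64 ^ r - 14 * x + 7 * P - 6) * y * u m) (16^ r) ([1/16]^ r) ⟩
    (1 / 3) * (P - 1) * (Q * Q) * N m - (1 / 90) * (2 * (P * P) - 25 * P + 23) * (Q * Q)
      - (1 / 420) * (13 * 64 ^ r - 14 * (P * P) + 7 * P - 6) * (Q * Q) * u m
      ≡⟨ cong (λ z → (1 / 3) * (P - 1) * (Q * Q) * N m - (1 / 90) * (2 * (P * P) - 25 * P + 23) * (Q * Q)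
           - (1 / 420) * (13 * z - 14 * (P * P) + 7 * P - 6) * (Q * Q) * u m) (64^ r) ⟩
    (1 / 3) * (P - 1) * (Q * Q) * N m - (1 / 90) * (2 * (P * P) - 25 * P + 23) * (Q * Q)
      - (1 / 420) * (13 * (P * P * P) - 14 * (P * P) + 7 * P - 6) * (Q * Q) * u m
      ≡⟨ expose P Q (N m) (u m) ⟩
    reduced (P * Q)
      ≡⟨ cong reduced (4^*[1/4]^ r) ⟩
    reduced 1
      ≡⟨ simplify P Q (N m) (u m) ⟩
    varianceTarget P Q (N m) (u m) ∎)
    where
    open ≡-Reasoning
    -- Every factor P is paired with a Q where possible, and the argument stands for P Q, which is
    -- then replaced by 1.
    reduced : ℚ → ℚ
    reduced x = (1 / 3) * (Q * x - Q * Q) * N m + - (1 / 90) * (2 * (x * x) - 25 * (Q * x) + 23 * (Q * Q))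
      + - (1 / 420) * (13 * (P * (x * x)) - 14 * (x * x) + 7 * (Q * x) - 6 * (Q * Q)) * u m
    expose : ∀ P Q N u → (1 / 3) * (P - 1) * (Q * Q) * N - (1 / 90) * (2 * (P * P) - 25 * P + 23) * (Q * Q)
        - (1 / 420) * (13 * (P * P * P) - 14 * (P * P) + 7 * P - 6) * (Q * Q) * u
      ≡ (1 / 3) * (Q * (P * Q) - Q * Q) * N + - (1 / 90) * (2 * (P * Q * (P * Q)) - 25 * (Q * (P * Q)) + 23 * (Q * Q))
        + - (1 / 420) * (13 * (P * (P * Q * (P * Q))) - 14 * (P * Q * (P * Q)) + 7 * (Q * (P * Q)) - 6 * (Q * Q)) * u
    expose = solve-∀ ℚ-ring
    simplify : ∀ P Q N u → (1 / 3) * (Q * 1 - Q * Q) * N + - (1 / 90) * (2 * (1 * 1) - 25 * (Q * 1) + 23 * (Q * Q))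
        + - (1 / 420) * (13 * (P * (1 * 1)) - 14 * (1 * 1) + 7 * (Q * 1) - 6 * (Q * Q)) * u
      ≡ (1 / 3) * (Q - Q * Q) * N + - (1 / 90) * (2 - 25 * Q + 23 * (Q * Q))
        + - (1 / 420) * (13 * P - 14 + 7 * Q - 6 * (Q * Q)) * u
    simplify = solve-∀ ℚ-ring
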